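{- A process $p$ is a parallel pushdown process if and only if there are a finite data set $\mathcal{D}$ and a regular process $q$ such that $p$ is divergence-preserving branching bisimilar to $$\tau_{\{i,o\}}\bigl(\partial_{\{i,o\}}(q\parallel \mathit{AB}^{io})\bigr),$$ where $q$ may use get actions, and $\mathit{AB}^{io}$ is the process over $\mathcal{D}$ defined by $\mathit{AB}^{io}\stackrel{\mathrm{def}}{=}\mathbf{1}+\sum_{d\in\mathcal{D}}i?d.\bigl(\mathit{AB}^{io}\parallel(\mathbf{1}+o!d.\mathbf{1})\bigr)$.
   Context: **Labelled transition systems, process graphs, processes.** A labelled transition system is a tuple $(\mathcal{S},\mathcal{A},\rightarrow,\downarrow)$ with $\mathcal{S}$ a set of states, $\mathcal{A}$ a set of actions, $\tau\notin\mathcal{A}$ the silent action, $\rightarrow\,\subseteq\mathcal{S}\times(\mathcal{A}\cup\{\tau\})\times\mathcal{S}$, and $\downarrow\,\subseteq\mathcal{S}$ the accepting states. A process graph is a labelled transition system with a designated root state. Write $s\Rightarrow t$ if $t$ can be reached from $s$ by zero or more $\tau$-transitions, $s\Rightarrow^{+}t$ if by one or more, and $s\xrightarrow{(a)}t$ if $s\xrightarrow{a}t$, or $a=\tau$ and $s=t$. A symmetric relation $R$ on $\mathcal{S}$ is a branching bisimulation if for all $s\mathrel{R}t$ and $a\in\mathcal{A}\cup\{\tau\}$: (1) if $s\xrightarrow{a}s'$ then there are $t'',t'$ with $t\Rightarrow t''\xrightarrow{(a)}t'$, $s\mathrel{R}t''$ and $s'\mathrel{R}t'$; (2) if $s\downarrow$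 then there is $t'$ with $t\Rightarrow t'$ and $t'\downarrow$. It is divergence-preserving if for all $s,t$, whenever there is an infinite sequence $s=s_0\xrightarrow{\tau}s_1\xrightarrow{\tau}\cdots$ with $s_k\mathrel{R}t$ for all $k\geq 0$, there is $t'$ with $t\Rightarrow^{+}t'$ and $s_k\mathrel{R}t'$ for some $k\geq 0$. States are divergence-preserving branching bisimilar if some divergence-preserving branching bisimulation relates them; process graphs are if their roots are, in the disjoint union of the underlying systems. A process is an equivalence class of process graphs under this relation (and is also denoted by any process graph representing it). A regular process is one given by a finite automaton, i.e. a process graph with finitely many states and transitions. A parallel pushdown process is the process of $\mathcal{P}(M)$ for some parallel pushdown automaton $M$. **Parallel pushdown automata.** $\mathcal{D}^{\{\!\{\,\}\!\}}$ is the set of finite multisets (bags) over $\mathcal{D}$, $\cup$ on bags is multiset sum, and $\mathcal{D}^{\pm}=\{+d\mid d\in\mathcal{D}\}\cup\{ -d\mid d\in\mathcal{D}\}$ (two disjoint copies of $\mathcal{D}$). A parallel pushdown automaton is a tuple $M=(\mathcal{S},\mathcal{A},\mathcal{D},\rightarrow,\uparrow,\downarrow)$ with $\mathcal{S}$ a finite set of states, $\mathcal{A}$ a finite input alphabet ($\tau\notin\mathcal{A}$), $\mathcal{D}$ a finite data alphabet, $\rightarrow\,\subseteq\mathcal{S}\times(\mathcal{A}\cup\{\tau\})\times\mathcal{D}^{\pm}\times\mathcal{D}^{\{\!\{\,\}\!\}}\times\mathcal{S}$ a finite set of transitions, $\uparrow\,\in\mathcal{S}$ the initial state, and $\downarrow\,\subseteq\mathcal{S}$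 the accepting states. Write $s\xrightarrow{a[+d/x]}t$ for $(s,a,+d,x,t)\in\,\rightarrow$, and $s\xrightarrow{a[-d/x]}t$ for $(s,a,-d,x,t)\in\,\rightarrow$. The process graph $\mathcal{P}(M)$ has states $(s,x)$ with $s\in\mathcal{S}$, $x\in\mathcal{D}^{\{\!\{\,\}\!\}}$; root $(\uparrow,\emptyset)$; accepting states all $(s,x)$ with $s\in\,\downarrow$; and exactly the transitions $(s,\{\!\{d\}\!\}\cup x)\xrightarrow{a}(s',x'\cup x)$ whenever $s\xrightarrow{a[+d/x']}s'$, and $(s,x)\xrightarrow{a}(s',x'\cup x)$ whenever there is $d\notin x$ with $s\xrightarrow{a[-d/x']}s'$. **Operators, with get communication.** $i,o$ are two distinct communication ports reserved for the internal communication (they do not occur in actions of $p$). For a port $c$ and $d\in\mathcal{D}$ there are the following actions: send $c!d$, receive $c?d$, get $c?\!?^{+}d$, failed get $c?\!?^{ - }d$, communication $c(d)$, and failed communication $c\times d$. For a set $C$ of ports, $\mathit{COM}_C=\{c!d,\;c?d,\;c?\!?^{+}d,\;c?\!?^{ - }d\mid c\in C,d\in\mathcal{D}\}$. The operational rules are: $\mathbf{1}\downarrow$; $a.p\xrightarrow{a}p$; $p+q$ has all transitions of $p$ and of $q$ and accepts if $p$ or $q$ does; $(p\parallel q)\downarrow$ if $p\downarrow$ and $q\downarrow$; if $p\xrightarrow{a}p'$ then $p\parallel q\xrightarrow{a}p'\parallel q$ and $q\parallel p\xrightarrow{a}q\parallel p'$; if $p\xrightarrow{c!d}p'$ and $q\xrightarrow{c?d}q'$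 then $p\parallel q\xrightarrow{c(d)}p'\parallel q'$ and $q\parallel p\xrightarrow{c(d)}q'\parallel p'$; if $p\xrightarrow{c?\!?^{+}d}p'$ and $q\xrightarrow{c!d}q'$ then $p\parallel q\xrightarrow{c(d)}p'\parallel q'$ and $q\parallel p\xrightarrow{c(d)}q'\parallel p'$; if $p\xrightarrow{c?\!?^{ - }d}p'$ and $q$ has no $c!d$-transition then $p\parallel q\xrightarrow{c\times d}p'\parallel q$ and $q\parallel p\xrightarrow{c\times d}q\parallel p'$; if $p\downarrow$ then $\partial_C(p)\downarrow$ and $\tau_C(p)\downarrow$; if $p\xrightarrow{a}p'$ and $a\notin\mathit{COM}_C$ then $\partial_C(p)\xrightarrow{a}\partial_C(p')$; if $p\xrightarrow{a}p'$ with $a=c(d)$ or $a=c\times d$ for some $c\in C$, $d\in\mathcal{D}$, then $\tau_C(p)\xrightarrow{\tau}\tau_C(p')$; if $p\xrightarrow{a}p'$ and $a$ is not of the form $c(d)$ or $c\times d$ with $c\in C$, then $\tau_C(p)\xrightarrow{a}\tau_C(p')$; an identifier $X$ with defining equation $X\stackrel{\mathrm{def}}{=}p$ has the transitions and acceptance of $p$. These operators are applied to process graphs via the same rules. -}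

module Defs where

open import Data.Empty using (⊥)
open import Data.Fin.Base using (Fin)
open import Data.Fin.Subset using (Subset) renaming (_∈_ to _∈ₛ_)
open import Data.List.Base using (List)
open import Data.List.Membership.Propositional using (_∈_)
open import Data.Maybe.Base as Maybe using (Maybe; just; nothing)
open import Data.Nat.Base as ℕ using (ℕ; zero; suc)
open import Data.Product.Base using (∃; ∃-syntax; Σ-syntax; _×_; _,_)
open import Data.Sum.Base using (_⊎_; inj₁; inj₂; [_,_]′)
open import Data.Unit.Base using (⊤; tt)
open import Data.Vec.Base as Vec using (Vec)
import Data.Vec.Functional as Vector
open import Level using (0ℓ)
open import Relation.Binary.Core using (Rel)
open import Relation.Binary.Definitions using (Symmetric)
open import Relation.Binary.Construct.Closure.ReflexiveTransitive using (Star)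
open import Relation.Binary.Construct.Closure.Transitive using (TransClosure)
open import Relation.Binary.PropositionalEquality using (_≡_)
open import Relation.Nullary using (¬_)

Label : Set → Set
Label A = Maybe A

pattern τ     = nothing
pattern act a = just a

record LTS (A : Set) : Set₁ where
  field
    State  : Set
    Step   : State → Label A → State → Set
    Accept : State → Set

  _⇒_ : Rel State 0ℓ
  _⇒_ = Star (λ s t → Step s τ t)

  _⇒⁺_ : Rel State 0ℓ
  _⇒⁺_ = TransClosure (λ s t → Step s τ t)

  OptStep : State → Label A → State → Set
  OptStep s a t = Step s a t ⊎ (a ≡ τ × s ≡ t)

record ProcessGraph (A : Set) : Set₁ where
  field
    lts  : LTS A
    root : LTS.State lts
  open LTS lts public

module _ {A : Set} (L : LTS A) where
  open LTS L

  record IsBranchingBisimulation (R : Rel State 0ℓ) : Set where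
    field
      symmetric  : Symmetric R
      simulates  : ∀ {s t a s′} → R s t → Step s a s′ →
                   ∃[ t″ ] ∃[ t′ ] (t ⇒ t″ × OptStep t″ a t′ × R s t″ × R s′ t′)
      terminates : ∀ {s t} → R s t → Accept s → ∃[ t′ ] (t ⇒ t′ × Accept t′)

  DivergencePreserving : Rel State 0ℓ → Set
  DivergencePreserving R =
    ∀ {t} (s : ℕ → State) →
    (∀ k → Step (s k) τ (s (suc k))) →
    (∀ k → R (s k) t) →
    ∃[ t′ ] (t ⇒⁺ t′ × ∃[ k ] R (s k) t′)

  Bisimilar : State → State → Set₁
  Bisimilar s t = Σ[ R ∈ Rel State 0ℓ ]
    (IsBranchingBisimulation R × DivergencePreserving R × R s t)

module _ {A : Set} (L₁ L₂ : LTS A) where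
  private
    module L₁ = LTS L₁
    module L₂ = LTS L₂

  data UnionStep : L₁.State ⊎ L₂.State → Label A → L₁.State ⊎ L₂.State → Set where
    left  : ∀ {s a t} → L₁.Step s a t → UnionStep (inj₁ s) a (inj₁ t)
    right : ∀ {s a t} → L₂.Step s a t → UnionStep (inj₂ s) a (inj₂ t)

  disjointUnion : LTS A
  disjointUnion = record
    { State  = L₁.State ⊎ L₂.State
    ; Step   = UnionStep
    ; Accept = [ L₁.Accept , L₂.Accept ]′
    }

infix 4 _≈ᵇ_

_≈ᵇ_ : ∀ {A} → ProcessGraph A → ProcessGraph A → Set₁
G ≈ᵇ H = Bisimilar (disjointUnion G.lts H.lts) (inj₁ G.root) (inj₂ H.root)
  where
  module G = ProcessGraph G
  module H = ProcessGraph H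

rename : ∀ {A B} → (A → B) → ProcessGraph A → ProcessGraph B
rename f G = record
  { lts = record
    { State  = State
    ; Step   = λ s b t → ∃[ a ] (b ≡ Maybe.map f a × Step s a t)
    ; Accept = Accept
    }
  ; root = root
  }
  where open ProcessGraph G

record FiniteAutomaton (A : Set) : Set where
  field
    states      : ℕ
    transitions : List (Fin states × Label A × Fin states)
    initial     : Fin states
    accepting   : Subset states

  graph : ProcessGraph A
  graph = record
    { lts = record
      { State  = Fin states
      ; Step   = λ s a t → (s , a , t) ∈ transitions
      ; Accept = _∈ₛ accepting
      }
    ; root = initial
    }

-- Finite bags over Fin n are vectors of multiplicities, so that equal bags
-- are propositionally equal.
Bag : ℕ → Set
Bag n = Vec ℕ n

module _ {n : ℕ} where
  infixr 6 _∪_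
  infix  4 _∉_

  ∅ : Bag n
  ∅ = Vec.replicate n 0

  ⟅_⟆ : Fin n → Bag n
  ⟅ d ⟆ = ∅ Vec.[ d ]≔ 1

  _∪_ : Bag n → Bag n → Bag n
  _∪_ = Vec.zipWith ℕ._+_

  _∉_ : Fin n → Bag n → Set
  d ∉ x = Vec.lookup x d ≡ 0

data Signed (D : Set) : Set where
  ⊕_ ⊝_ : D → Signed D

record PPDA (A : Set) : Set where
  field
    states      : ℕ
    alphabet    : List A
    data#       : ℕ
    transitions : List (Fin states × Label A × Signed (Fin data#) × Bag data# × Fin states)
    labelled    : ∀ {s a d x t} → (s , act a , d , x , t) ∈ transitions → a ∈ alphabet
    initial     : Fin states
    accepting   : Subset states

  State : Set
  State = Fin states × Bag data#

  data Step : State → Label A → State → Set where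
    remove : ∀ {s a d x′ s′ x y} → (s , a , ⊕ d , x′ , s′) ∈ transitions →
             y ≡ ⟅ d ⟆ ∪ x → Step (s , y) a (s′ , x′ ∪ x)
    absent : ∀ {s a d x′ s′ x} → (s , a , ⊝ d , x′ , s′) ∈ transitions →
             d ∉ x → Step (s , x) a (s′ , x′ ∪ x)

  𝒫 : ProcessGraph A
  𝒫 = record
    { lts = record
      { State  = State
      ; Step   = Step
      ; Accept = λ (s , _) → s ∈ₛ accepting
      }
    ; root = initial , ∅
    }

IsParallelPushdownProcess : ∀ {A} → ProcessGraph A → Set₁
IsParallelPushdownProcess {A} p = Σ[ M ∈ PPDA A ] (p ≈ᵇ PPDA.𝒫 M)

-- basic b  involves no port: an action that cannot take part in communication.
data Action (Port B D : Set) : Set where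
  basic                             : B → Action Port B D
  send receive get⁺ get⁻            : Port → D → Action Port B D
  communication failedCommunication : Port → D → Action Port B D

module _ {Port B D : Set} where

  data COM (C : List Port) : Label (Action Port B D) → Set where
    send    : ∀ {c d} → c ∈ C → COM C (act (send c d))
    receive : ∀ {c d} → c ∈ C → COM C (act (receive c d))
    get⁺    : ∀ {c d} → c ∈ C → COM C (act (get⁺ c d))
    get⁻    : ∀ {c d} → c ∈ C → COM C (act (get⁻ c d))

  data Communication (C : List Port) : Label (Action Port B D) → Set where
    succeeded : ∀ {c d} → c ∈ C → Communication C (act (communication c d))
    failed    : ∀ {c d} → c ∈ C → Communication C (act (failedCommunication c d))

infixr 8 _·_
infixr 7 _∥_
infixr 6 _＋_

-- Q is the type of states of a given transition system, whose states
-- serve as constants; X is the type of identifiers.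
data Proc (Port B D Q X : Set) : Set where
  𝟎 𝟏     : Proc Port B D Q X
  _·_     : Label (Action Port B D) → Proc Port B D Q X → Proc Port B D Q X
  _＋_ _∥_ : Proc Port B D Q X → Proc Port B D Q X → Proc Port B D Q X
  ∂ hide  : List Port → Proc Port B D Q X → Proc Port B D Q X
  var     : X → Proc Port B D Q X
  ⌜_⌝     : Q → Proc Port B D Q X

∑ : ∀ {Port B D Q X n} → (Fin n → Proc Port B D Q X) → Proc Port B D Q X
∑ = Vector.foldr _＋_ 𝟎

module Semantics {Port B D X : Set} (L : LTS (Action Port B D))
                 (def : X → Proc Port B D (LTS.State L) X) where
  open LTS L using () renaming (State to Q; Step to StepL; Accept to AcceptL)

  private
    P : Set
    P = Proc Port B D Q X

  data Accepting : P → Set where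
    𝟏↓    : Accepting 𝟏
    ＋ˡ↓  : ∀ {p q} → Accepting p → Accepting (p ＋ q)
    ＋ʳ↓  : ∀ {p q} → Accepting q → Accepting (p ＋ q)
    ∥↓    : ∀ {p q} → Accepting p → Accepting q → Accepting (p ∥ q)
    ∂↓    : ∀ {C p} → Accepting p → Accepting (∂ C p)
    hide↓ : ∀ {C p} → Accepting p → Accepting (hide C p)
    var↓  : ∀ {x} → Accepting (def x) → Accepting (var x)
    ⌜⌝↓   : ∀ {s} → AcceptL s → Accepting ⌜ s ⌝

  -- The rules, relative to a predicate  NoSend c d q  that stands for the
  -- negative premise "q has no c!d-transition"; it is resolved by
  -- stratification below.
  module Rules (NoSend : Port → D → P → Set) where

    data _⟶[_]_ : P → Label (Action Port B D) → P → Set where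
      prefix  : ∀ {a p} → (a · p) ⟶[ a ] p
      ＋ˡ     : ∀ {p q a p′} → p ⟶[ a ] p′ → (p ＋ q) ⟶[ a ] p′
      ＋ʳ     : ∀ {p q a q′} → q ⟶[ a ] q′ → (p ＋ q) ⟶[ a ] q′
      ∥ˡ      : ∀ {p q a p′} → p ⟶[ a ] p′ → (p ∥ q) ⟶[ a ] (p′ ∥ q)
      ∥ʳ      : ∀ {p q a q′} → q ⟶[ a ] q′ → (p ∥ q) ⟶[ a ] (p ∥ q′)
      sendˡ   : ∀ {p q c d p′ q′} →
                p ⟶[ act (send c d) ] p′ → q ⟶[ act (receive c d) ] q′ →
                (p ∥ q) ⟶[ act (communication c d) ] (p′ ∥ q′)
      sendʳ   : ∀ {p q c d p′ q′} →
                p ⟶[ act (receive c d) ] p′ → q ⟶[ act (send c d) ] q′ →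
                (p ∥ q) ⟶[ act (communication c d) ] (p′ ∥ q′)
      getˡ    : ∀ {p q c d p′ q′} →
                p ⟶[ act (get⁺ c d) ] p′ → q ⟶[ act (send c d) ] q′ →
                (p ∥ q) ⟶[ act (communication c d) ] (p′ ∥ q′)
      getʳ    : ∀ {p q c d p′ q′} →
                p ⟶[ act (send c d) ] p′ → q ⟶[ act (get⁺ c d) ] q′ →
                (p ∥ q) ⟶[ act (communication c d) ] (p′ ∥ q′)
      failˡ   : ∀ {p q c d p′} →
                p ⟶[ act (get⁻ c d) ] p′ → NoSend c d q →
                (p ∥ q) ⟶[ act (failedCommunication c d) ] (p′ ∥ q)
      failʳ   : ∀ {p q c d q′} →
                q ⟶[ act (get⁻ c d) ] q′ → NoSend c d p →
                (p ∥ q) ⟶[ act (failedCommunication c d) ] (p ∥ q′)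
      encap   : ∀ {C p a p′} →
                p ⟶[ a ] p′ → ¬ COM C a → ∂ C p ⟶[ a ] ∂ C p′
      hidden  : ∀ {C p a p′} →
                p ⟶[ a ] p′ → Communication C a → hide C p ⟶[ τ ] hide C p′
      visible : ∀ {C p a p′} →
                p ⟶[ a ] p′ → ¬ Communication C a → hide C p ⟶[ a ] hide C p′
      unfold  : ∀ {x a p′} → def x ⟶[ a ] p′ → var x ⟶[ a ] p′
      state   : ∀ {s a s′} → StepL s a s′ → ⌜ s ⌝ ⟶[ a ] ⌜ s′ ⌝

  open Rules public using (prefix; ＋ˡ; ＋ʳ; ∥ˡ; ∥ʳ; sendˡ; sendʳ; getˡ; getʳ;
                           failˡ; failʳ; encap; hidden; visible; unfold; state)

  -- No derivation of a c!d-transition uses failˡ or failʳ, so the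
  -- c!d-transitions are already those derivable without these two rules.
  NoSend : Port → D → P → Set
  NoSend c d q = ∀ q′ → ¬ (q ⟶₀[ act (send c d) ] q′)
    where open Rules (λ _ _ _ → ⊥) renaming (_⟶[_]_ to _⟶₀[_]_)

  open Rules NoSend public using (_⟶[_]_)

  send-independent : ∀ {N N′ : Port → D → P → Set} {c d p p′} →
    Rules._⟶[_]_ N p (act (send c d)) p′ → Rules._⟶[_]_ N′ p (act (send c d)) p′
  send-independent prefix        = prefix
  send-independent (＋ˡ r)        = ＋ˡ (send-independent r)
  send-independent (＋ʳ r)        = ＋ʳ (send-independent r)
  send-independent (∥ˡ r)        = ∥ˡ (send-independent r)
  send-independent (∥ʳ r)        = ∥ʳ (send-independent r)
  send-independent (encap r n)   = encap (send-independent r) n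
  send-independent (visible r n) = visible (send-independent r) n
  send-independent (unfold r)    = unfold (send-independent r)
  send-independent (state r)     = state r

  NoSend-sound : ∀ {c d q} → NoSend c d q → ∀ q′ → ¬ (q ⟶[ act (send c d) ] q′)
  NoSend-sound n q′ r = n q′ (send-independent r)

  NoSend-complete : ∀ {c d q} → (∀ q′ → ¬ (q ⟶[ act (send c d) ] q′)) → NoSend c d q
  NoSend-complete n q′ r = n q′ (send-independent r)

  ⟦_⟧ : P → ProcessGraph (Action Port B D)
  ⟦ p ⟧ = record
    { lts  = record { State = P ; Step = _⟶[_]_ ; Accept = Accepting }
    ; root = p
    }

module _ {Port B Q : Set} {n : ℕ} (i o : Port) where

  AB : Proc Port B (Fin n) Q ⊤
  AB = var tt

  AB-def : ⊤ → Proc Port B (Fin n) Q ⊤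
  AB-def _ = 𝟏 ＋ ∑ λ d →
    act (receive i d) · (AB ∥ (𝟏 ＋ act (send o d) · 𝟏))

withBag : ∀ {Port B n} (i o : Port) →
          ProcessGraph (Action Port B (Fin n)) → ProcessGraph (Action Port B (Fin n))
withBag i o q = ⟦ hide io (∂ io (⌜ q.root ⌝ ∥ AB i o)) ⟧
  where
  module q = ProcessGraph q
  io = i List.∷ o List.∷ List.[]
  open Semantics q.lts (AB-def i o)

{-# OPTIONS --safe #-}
-- Up to strong bisimulation, τ(∂(q ∥ AB)) is q equipped with a bag of data: the
-- terms reachable from AB only matter through the multiset of their pending o!d.
--
-- A pushdown transition both tests the bag and may be in conflict with other
-- transitions, so a control q must not commit itself before the visible step.
-- It therefore first takes one copy of every datum that is present out of the
-- bag and records which data are absent. All transitions can then be fired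
-- atomically on the copies held; afterwards the control puts everything it holds
-- back one by one. The communication steps in between preserve the sum of the
-- bag and the data held, and a measure of the control decreases, so they are
-- inert and cause no divergence.
--
-- Conversely, a transition of q becomes a pushdown transition with at most one
-- change of the bag; transitions without any condition on the bag test the
-- absence of an additional datum that never occurs.
module Submission where

open import Axiom.ExcludedMiddle using (ExcludedMiddle)
open import Data.Bool.Base using (true)
open import Data.Fin.Base using (Fin; zero; suc)
open import Data.Fin.Properties using (_≟_; all?; ¬∀⟶∃¬)
open import Data.Fin.Subset using () renaming (_∈_ to _∈ₛ_)
open import Data.List.Base as List
  using (List; []; _∷_; _++_; upTo; allFin; concatMap; filter;
         cartesianProduct; cartesianProductWith)
open import Data.List.Extrema.Nat using (max; xs≤max)
open import Data.List.Membership.Propositional using (_∈_; lose)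
open import Data.List.Membership.Propositional.Properties
  using (∈-filter⁺; ∈-filter⁻; ∈-cartesianProduct⁺; ∈-cartesianProduct⁻;
         ∈-cartesianProductWith⁺; ∈-cartesianProductWith⁻; ∈-allFin; ∈-lookup;
         ∈-upTo⁺; ∈-upTo⁻; ∈-++⁺ˡ; ∈-++⁺ʳ; ∈-concatMap⁺; ∈-map⁺)
import Data.List.Relation.Unary.All as All
open import Data.List.Relation.Unary.Any using (here; there; index)
open import Data.List.Relation.Unary.Any.Properties using (lookup-index)
open import Data.Maybe.Base as Maybe using (Maybe; just; nothing)
open import Data.Maybe.Properties using (map-injective)
open import Data.Nat.Base as ℕ using (ℕ; zero; suc; _≤_; _<_; z≤n; s≤s)
open import Data.Nat.Induction using (Acc; acc; <-wellFounded)
open import Data.Nat.Properties as ℕₚ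
  using (+-identityˡ; +-comm; +-assoc; +-cancelˡ-≡; _≤?_; ≤-refl; ≤-trans; <-trans; ≤-reflexive;
         +-mono-≤; +-monoˡ-<; +-monoʳ-<; m≤m+n; m≤n+m; m+n≡0⇒m≡0)
open import Data.Product.Base using (∃-syntax; Σ-syntax; _×_; _,_; proj₁; proj₂)
open import Data.Sum.Base using (_⊎_; inj₁; inj₂)
open import Data.Unit.Base using (⊤)
open import Data.Vec.Base as Vec using (Vec; []; _∷_; lookup; _[_]≔_)
open import Data.Vec.Properties
  using (∷-injectiveˡ; ∷-injectiveʳ; zipWith-identityˡ; zipWith-comm; zipWith-assoc; lookup-zipWith;
         lookup∘update; lookup∘update′; lookup-replicate; lookup∘tabulate; []=⇒lookup; lookup⇒[]=;
         map-∘; map-id; lookup-map)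
open import Function.Base using (flip; _∘_)
open import Function.Bundles using (_⇔_; mk⇔)
open import Function.Definitions using (Injective)
open import Level using (0ℓ)
open import Relation.Binary.Core using (REL; Rel)
open import Relation.Binary.Construct.Closure.ReflexiveTransitive
  as Star using (Star; ε; _◅_; _◅◅_)
open import Relation.Binary.Construct.Closure.Transitive using (TransClosure; [_]; _∷_)
open import Relation.Binary.Construct.Composition using () renaming (_;_ to _⨾_)
open import Relation.Binary.Construct.Union using () renaming (_∪_ to _∪ᴿ_)
open import Relation.Binary.PropositionalEquality
  using (_≡_; _≢_; refl; sym; trans; cong; cong₂; subst)
open import Relation.Nullary using (¬_; Dec; yes; no; contradiction; does)
open import Relation.Nullary.Decidable using (dec-true)
open import Defs

-- Divergence-preserving branching bisimilarity

private variable
  A B : Set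
  n   : ℕ

module _ {X : Set} {_⟶_ : Rel X 0ℓ} where

  ⁺⇒* : ∀ {x y} → TransClosure _⟶_ x y → Star _⟶_ x y
  ⁺⇒* [ s ]    = s ◅ ε
  ⁺⇒* (s ∷ ss) = s ◅ ⁺⇒* ss

  infixr 5 _⁺◅◅_ _◅⁺_
  infixl 5 _◅◅⁺_

  _◅⁺_ : ∀ {x y z} → x ⟶ y → Star _⟶_ y z → TransClosure _⟶_ x z
  s ◅⁺ ε        = [ s ]
  s ◅⁺ (t ◅ ts) = s ∷ (t ◅⁺ ts)

  _◅◅⁺_ : ∀ {x y z} → Star _⟶_ x y → y ⟶ z → TransClosure _⟶_ x z
  ε        ◅◅⁺ t = [ t ]
  (s ◅ ss) ◅◅⁺ t = s ∷ (ss ◅◅⁺ t)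

  _⁺◅◅_ : ∀ {x y z} → TransClosure _⟶_ x y → Star _⟶_ y z → TransClosure _⟶_ x z
  [ s ]    ⁺◅◅ ts = s ◅⁺ ts
  (s ∷ ss) ⁺◅◅ ts = s ∷ (ss ⁺◅◅ ts)

module _ (L : LTS A) where
  open LTS L

  IsDivergence : (ℕ → State) → Set
  IsDivergence s = ∀ k → Step (s k) τ (s (suc k))

-- Unlike in DivergencePreserving, only the first state of a divergence has to
-- be related to t. For branching bisimulations the two conditions agree
-- classically, but this one is visibly closed under unions and compositions.
record Simulation (L K : LTS A) (R : REL (LTS.State L) (LTS.State K) 0ℓ) : Set where
  private
    module L = LTS L
    module K = LTS K
  field
    simulates  : ∀ {s t a s′} → R s t → L.Step s a s′ →
                 ∃[ t″ ] ∃[ t′ ] (t K.⇒ t″ × K.OptStep t″ a t′ × R s t″ × R s′ t′)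
    terminates : ∀ {s t} → R s t → L.Accept s → ∃[ t′ ] (t K.⇒ t′ × K.Accept t′)
    diverges   : ∀ {t} s → IsDivergence L s → R (s 0) t →
                 ∃[ t′ ] (t K.⇒⁺ t′ × ∃[ k ] R (s k) t′)

  simulates* : ∀ {s t s′} → R s t → s L.⇒ s′ → ∃[ t′ ] (t K.⇒ t′ × R s′ t′)
  simulates* r ε = _ , ε , r
  simulates* r (x ◅ xs) with simulates r x
  ... | _ , _ , p , inj₁ st         , _ , r′ with simulates* r′ xs
  ...   | _ , p′ , r″ = _ , p ◅◅ st ◅ p′ , r″
  simulates* r (x ◅ xs) | _ , _ , p , inj₂ (_ , refl) , _ , r′ with simulates* r′ xs
  ...   | _ , p′ , r″ = _ , p ◅◅ p′ , r″

record IsStrongSimulation (L K : LTS A) (R : REL (LTS.State L) (LTS.State K) 0ℓ) : Set where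
  private
    module L = LTS L
    module K = LTS K
  field
    step   : ∀ {s t a s′} → R s t → L.Step s a s′ → ∃[ t′ ] (K.Step t a t′ × R s′ t′)
    accept : ∀ {s t} → R s t → L.Accept s → K.Accept t

  simulation : Simulation L K R
  simulation = record
    { simulates  = λ r x → let _ , y , r′ = step r x in _ , _ , ε , inj₁ y , r , r′
    ; terminates = λ r a → _ , ε , accept r a
    ; diverges   = λ s d r → let _ , y , r′ = step r (d 0) in _ , [ y ] , 1 , r′
    }

open IsStrongSimulation using (simulation)

module _ {L K M : LTS A} {R : REL (LTS.State L) (LTS.State K) 0ℓ}
         {S : REL (LTS.State K) (LTS.State M) 0ℓ} where
  private
    module L = LTS L
    module K = LTS K
    module M = LTS M

  ⨾-simulation : Simulation L K R → Simulation K M S → Simulation L M (R ⨾ S)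
  ⨾-simulation F G = record { simulates = sim ; terminates = term ; diverges = div }
    where
    module F = Simulation F
    module G = Simulation G

    sim : ∀ {s u a s′} → (R ⨾ S) s u → L.Step s a s′ →
          ∃[ u″ ] ∃[ u′ ] (u M.⇒ u″ × M.OptStep u″ a u′ × (R ⨾ S) s u″ × (R ⨾ S) s′ u′)
    sim (t , r , q) x with F.simulates r x
    ... | t″ , t′ , p , o , r″ , r′ with G.simulates* q p
    sim _ x | t″ , t′ , p , inj₂ (refl , refl) , r″ , r′ | u″ , p″ , q″ =
      u″ , u″ , p″ , inj₂ (refl , refl) , (t″ , r″ , q″) , (t″ , r′ , q″)
    sim _ x | t″ , t′ , p , inj₁ y , r″ , r′ | u″ , p″ , q″ with G.simulates q″ y
    ... | v″ , v′ , p‴ , o , q‴ , q′ =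
      v″ , v′ , p″ ◅◅ p‴ , o , (t″ , r″ , q‴) , (t′ , r′ , q′)

    term : ∀ {s u} → (R ⨾ S) s u → L.Accept s → ∃[ u′ ] (u M.⇒ u′ × M.Accept u′)
    term (t , r , q) a with F.terminates r a
    ... | _ , p , a′ with G.simulates* q p
    ...   | _ , p′ , q′ with G.terminates q′ a′
    ...     | _ , p″ , a″ = _ , p′ ◅◅ p″ , a″

    module _ (s : ℕ → L.State) (d : IsDivergence L s) where

      Matched : K.State → Set
      Matched t = ∃[ k ] R (s k) t

      -- A divergence of K is built by following the finite τ-paths between
      -- successive matched states.
      Position : Set
      Position = ∃[ t ] ∃[ t* ] (t K.⇒ t* × Matched t*)

      next : (x : Position) → ∃[ y ] K.Step (proj₁ x) τ (proj₁ y)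
      next (t , t* , (x ◅ xs) , m) = (_ , t* , xs , m) , x
      -- At a matched state `F.diverges` is applied to the divergence from index `k` on. The path it
      -- returns is nonempty: its first step is taken now and the remainder becomes the new path.
      next (t , .t , ε , (k , r)) with F.diverges (s ∘ (ℕ._+ k)) (λ j → d _) r
      ... | t′ , [ x ]  , (j , r′) = (t′ , t′ , ε , (_ , r′)) , x
      ... | t′ , x ∷ xs , (j , r′) = (_ , t′ , ⁺⇒* xs , (_ , r′)) , x

      positions : Position → ℕ → Position
      positions x zero    = x
      positions x (suc k) = proj₁ (next (positions x k))

    div : ∀ {u} s → IsDivergence L s → (R ⨾ S) (s 0) u →
          ∃[ u′ ] (u M.⇒⁺ u′ × ∃[ k ] (R ⨾ S) (s k) u′)
    div s d (t , r , q)
      with G.diverges (proj₁ ∘ positions s d x₀) (proj₂ ∘ next s d ∘ positions s d x₀) q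
      where
      x₀ : Position s d
      x₀ = t , t , ε , (0 , r)
    ... | u′ , p , (k , q′) with positions s d (t , t , ε , (0 , r)) k
    -- Position `k` may lie inside a path that still leads to a matched state, so the answer `u′` is
    -- moved along the rest of that path.
    ...   | _ , t* , p* , (j , r*) with G.simulates* q′ p*
    ...     | u″ , p″ , q″ = u″ , p ⁺◅◅ p″ , (j , t* , r* , q″)

∪ᴿ-simulation : ∀ {L K : LTS A} {R S} → Simulation L K R → Simulation L K S →
                Simulation L K (R ∪ᴿ S)
∪ᴿ-simulation F G = record
  { simulates  = λ { (inj₁ r) x → let _ , _ , p , o , r″ , r′ = F.simulates r x in
                                  _ , _ , p , o , inj₁ r″ , inj₁ r′
                   ; (inj₂ r) x → let _ , _ , p , o , r″ , r′ = G.simulates r x in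
                                  _ , _ , p , o , inj₂ r″ , inj₂ r′ }
  ; terminates = λ { (inj₁ r) → F.terminates r ; (inj₂ r) → G.terminates r }
  ; diverges   = λ { s d (inj₁ r) → let _ , p , k , r′ = F.diverges s d r in _ , p , k , inj₁ r′
                   ; s d (inj₂ r) → let _ , p , k , r′ = G.diverges s d r in _ , p , k , inj₂ r′ }
  }
  where
  module F = Simulation F
  module G = Simulation G

module _ (em : ExcludedMiddle 0ℓ) {L : LTS A} {R : Rel (LTS.State L) 0ℓ} where
  open LTS L

  -- Suppose no nonempty τ-path from `t` ends in a state related to some `s k`. Then each step of
  -- the divergence can only be answered by staying at `t`, so `t` is related to every `s k` and
  -- `DivergencePreserving` applies.
  bisimulation⇒simulation : IsBranchingBisimulation L R → DivergencePreserving L R →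
                            Simulation L L R
  bisimulation⇒simulation bb dp = record
    { simulates = bb.simulates ; terminates = bb.terminates ; diverges = div }
    where
    module bb = IsBranchingBisimulation bb

    div : ∀ {t} s → IsDivergence L s → R (s 0) t → ∃[ t′ ] (t ⇒⁺ t′ × ∃[ k ] R (s k) t′)
    div {t} s d r with em {∃[ t′ ] (t ⇒⁺ t′ × ∃[ k ] R (s k) t′)}
    ... | yes moves = moves
    ... | no stuck  = dp s d stays
      where
      stays : ∀ k → R (s k) t
      stays zero    = r
      stays (suc k) with bb.simulates (stays k) (d k)
      ... | _ , _ , p      , inj₁ y          , _ , r′ = contradiction (_ , p ◅◅⁺ y , _ , r′) stuck
      ... | _ , _ , ε      , inj₂ (_ , refl) , _ , r′ = r′
      ... | _ , _ , x ◅ xs , inj₂ (_ , refl) , _ , r′ = contradiction (_ , x ◅⁺ xs , _ , r′) stuck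

infix 4 _≃_

-- A relation between the two graphs themselves that simulates in both directions; in contrast to
-- symmetric relations on disjoint unions, such relations compose directly.
_≃_ : ProcessGraph A → ProcessGraph A → Set₁
G ≃ H = ∃[ R ] (Simulation G.lts H.lts R × Simulation H.lts G.lts (flip R) × R G.root H.root)
  where
  module G = ProcessGraph G
  module H = ProcessGraph H

≃-sym : {G H : ProcessGraph A} → G ≃ H → H ≃ G
≃-sym (R , F , G , r) = flip R , G , F , r

module _ {L K : LTS A} {R S : REL (LTS.State L) (LTS.State K) 0ℓ}
         (to : ∀ {s t} → R s t → S s t) (from : ∀ {s t} → S s t → R s t) where

  simulation-resp : Simulation L K R → Simulation L K S
  simulation-resp F = record
    { simulates  = λ r x → let _ , _ , p , o , r″ , r′ = simulates (from r) x in
                           _ , _ , p , o , to r″ , to r′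
    ; terminates = λ r → terminates (from r)
    ; diverges   = λ s d r → let _ , p , k , r′ = diverges s d (from r) in _ , p , k , to r′
    }
    where open Simulation F

≃-trans : {G H K : ProcessGraph A} → G ≃ H → H ≃ K → G ≃ K
≃-trans (R , F , F′ , r) (S , G , G′ , q) =
  (R ⨾ S) , ⨾-simulation F G ,
  simulation-resp (λ (t , q , r) → t , r , q) (λ (t , r , q) → t , q , r) (⨾-simulation G′ F′) ,
  (_ , r , q)

module _ {X Y : Set} where

  -- The injections as relations, so that entering and leaving a disjoint union is composition with
  -- a strong simulation.
  inl : REL X (X ⊎ Y) 0ℓ
  inl s u = u ≡ inj₁ s

  inr : REL Y (X ⊎ Y) 0ℓ
  inr t u = u ≡ inj₂ t

module _ {L K : LTS A} where
  private
    U : LTS A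
    U = disjointUnion L K

  inl-simulation : Simulation L U inl
  inl-simulation = simulation record
    { step = λ { refl x → _ , left x , refl } ; accept = λ { refl a → a } }

  inl-simulation⁻ : Simulation U L (flip inl)
  inl-simulation⁻ = simulation record
    { step = λ { refl (left x) → _ , x , refl } ; accept = λ { refl a → a } }

  inr-simulation : Simulation K U inr
  inr-simulation = simulation record
    { step = λ { refl x → _ , right x , refl } ; accept = λ { refl a → a } }

  inr-simulation⁻ : Simulation U K (flip inr)
  inr-simulation⁻ = simulation record
    { step = λ { refl (right x) → _ , x , refl } ; accept = λ { refl a → a } }

-- Only the pairs of `R` that cross from the left to the right summand are kept; symmetry of `R`
-- supplies the simulation in the other direction.
≈ᵇ⇒≃ : ExcludedMiddle 0ℓ → {G H : ProcessGraph A} → G ≈ᵇ H → G ≃ H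
≈ᵇ⇒≃ em {G} {H} (R , bb , dp , r) =
  R′ , resp (⨾-simulation inl-simulation (⨾-simulation F inr-simulation⁻)) ,
  resp⁻ (⨾-simulation inr-simulation (⨾-simulation F inl-simulation⁻)) , r
  where
  module G = ProcessGraph G
  module H = ProcessGraph H
  open IsBranchingBisimulation bb using (symmetric)
  F : Simulation (disjointUnion G.lts H.lts) (disjointUnion G.lts H.lts) R
  F = bisimulation⇒simulation em bb dp
  R′ : REL G.State H.State 0ℓ
  R′ s t = R (inj₁ s) (inj₂ t)
  resp : Simulation G.lts H.lts (inl ⨾ (R ⨾ flip inr)) → Simulation G.lts H.lts R′
  resp = simulation-resp (λ { (_ , refl , _ , r , refl) → r }) (λ r → _ , refl , _ , r , refl)
  resp⁻ : Simulation H.lts G.lts (inr ⨾ (R ⨾ flip inl)) → Simulation H.lts G.lts (flip R′)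
  resp⁻ = simulation-resp (λ { (_ , refl , _ , r , refl) → symmetric r })
                          (λ r → _ , refl , _ , symmetric r , refl)

≃⇒≈ᵇ : {G H : ProcessGraph A} → G ≃ H → G ≈ᵇ H
≃⇒≈ᵇ {G = G} {H} (R , F , F⁻ , r) =
  R± ,
  record { symmetric = symmetric ; simulates = simulates ; terminates = terminates } ,
  -- The whole sequence is related to `t` here, whereas `diverges` asks for its first state.
  (λ s d r → diverges s d (r 0)) ,
  inj₁ (_ , refl , _ , r , refl)
  where
  module G = ProcessGraph G
  module H = ProcessGraph H
  R⁺ R⁻ R± : Rel (G.State ⊎ H.State) 0ℓ
  R⁺ = flip inl ⨾ (R ⨾ inr)
  R⁻ = flip inr ⨾ (flip R ⨾ inl)
  R± = R⁺ ∪ᴿ R⁻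
  symmetric : ∀ {u v} → R± u v → R± v u
  symmetric (inj₁ (s , i , t , r , j)) = inj₂ (t , j , s , r , i)
  symmetric (inj₂ (t , j , s , r , i)) = inj₁ (s , i , t , r , j)
  open Simulation (∪ᴿ-simulation
    (⨾-simulation inl-simulation⁻ (⨾-simulation F inr-simulation))
    (⨾-simulation inr-simulation⁻ (⨾-simulation F⁻ inl-simulation)))

-- Renaming of actions

module _ {f : A → B} (G : ProcessGraph A) where
  private
    module G = ProcessGraph G
    module G′ = ProcessGraph (rename f G)

  rename-step : ∀ {s a t} → G.Step s a t → G′.Step s (Maybe.map f a) t
  rename-step x = _ , refl , x

  unrename-τ : ∀ {s t} → G′.Step s τ t → G.Step s τ t
  unrename-τ (nothing , _ , x) = x

  rename-⇒ : ∀ {s t} → s G.⇒ t → s G′.⇒ t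
  rename-⇒ = Star.map rename-step

  unrename-⇒ : ∀ {s t} → s G′.⇒ t → s G.⇒ t
  unrename-⇒ = Star.map unrename-τ

  rename-⇒⁺ : ∀ {s t} → s G.⇒⁺ t → s G′.⇒⁺ t
  rename-⇒⁺ [ x ]    = [ rename-step x ]
  rename-⇒⁺ (x ∷ xs) = rename-step x ∷ rename-⇒⁺ xs

  unrename-⇒⁺ : ∀ {s t} → s G′.⇒⁺ t → s G.⇒⁺ t
  unrename-⇒⁺ [ x ]    = [ unrename-τ x ]
  unrename-⇒⁺ (x ∷ xs) = unrename-τ x ∷ unrename-⇒⁺ xs

  rename-opt : ∀ {s a t} → G.OptStep s a t → G′.OptStep s (Maybe.map f a) t
  rename-opt (inj₁ x)             = inj₁ (rename-step x)
  rename-opt (inj₂ (refl , refl)) = inj₂ (refl , refl)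

  unrename-opt : Injective _≡_ _≡_ f → ∀ {s a t} →
                 G′.OptStep s (Maybe.map f a) t → G.OptStep s a t
  unrename-opt inj (inj₁ (a , e , x)) =
    inj₁ (subst (λ a → G.Step _ a _) (sym (map-injective inj e)) x)
  unrename-opt inj {a = nothing} (inj₂ (_ , refl)) = inj₂ (refl , refl)

module _ {f : A → B} {G H : ProcessGraph A} where
  private
    module G = ProcessGraph G
    module H = ProcessGraph H
    module G′ = ProcessGraph (rename f G)
    module H′ = ProcessGraph (rename f H)

  rename-simulation : ∀ {R} → Simulation G.lts H.lts R → Simulation G′.lts H′.lts R
  rename-simulation F = record
    { simulates  = λ { r (a , refl , x) →
        let _ , _ , p , o , r″ , r′ = simulates r x in
        _ , _ , rename-⇒ H p , rename-opt H o , r″ , r′ }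
    ; terminates = λ r a → let _ , p , a′ = terminates r a in _ , rename-⇒ H p , a′
    ; diverges   = λ s d r → let _ , p , k , r′ = diverges s (unrename-τ G ∘ d) r in
                             _ , rename-⇒⁺ H p , k , r′
    }
    where open Simulation F

  -- Renaming leaves the states alone, so the same relation serves; injectivity recovers the label
  -- of an answer from its image.
  unrename-simulation : Injective _≡_ _≡_ f → ∀ {R} →
                        Simulation G′.lts H′.lts R → Simulation G.lts H.lts R
  unrename-simulation inj F = record
    { simulates  = λ r x →
        let _ , _ , p , o , r″ , r′ = simulates r (_ , refl , x) in
        _ , _ , unrename-⇒ H p , unrename-opt H inj o , r″ , r′
    ; terminates = λ r a → let _ , p , a′ = terminates r a in _ , unrename-⇒ H p , a′
    ; diverges   = λ s d r → let _ , p , k , r′ = diverges s (rename-step G ∘ d) r in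
                             _ , unrename-⇒⁺ H p , k , r′
    }
    where open Simulation F

module _ {f : A → B} {G H : ProcessGraph A} where

  rename-≃ : G ≃ H → rename f G ≃ rename f H
  rename-≃ (R , F , F⁻ , r) =
    R , rename-simulation {G = G} {H} F , rename-simulation {G = H} {G} F⁻ , r

  unrename-≃ : Injective _≡_ _≡_ f → rename f G ≃ rename f H → G ≃ H
  unrename-≃ inj (R , F , F⁻ , r) =
    R , unrename-simulation {G = G} {H} inj F , unrename-simulation {G = H} {G} inj F⁻ , r

-- The bag process

module _ {n : ℕ} where

  ∪-identityˡ : (x : Bag n) → ∅ ∪ x ≡ x
  ∪-identityˡ = zipWith-identityˡ +-identityˡ

  ∪-comm : (x y : Bag n) → x ∪ y ≡ y ∪ x
  ∪-comm = zipWith-comm +-comm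

  ∪-assoc : (x y z : Bag n) → (x ∪ y) ∪ z ≡ x ∪ (y ∪ z)
  ∪-assoc = zipWith-assoc +-assoc

  ∪-exchange : (x y z : Bag n) → x ∪ (y ∪ z) ≡ y ∪ (x ∪ z)
  ∪-exchange x y z = trans (sym (∪-assoc x y z)) (trans (cong (_∪ z) (∪-comm x y)) (∪-assoc y x z))

∪-cancelˡ : (x : Bag n) {y z : Bag n} → x ∪ y ≡ x ∪ z → y ≡ z
∪-cancelˡ []      {[]}    {[]}    _ = refl
∪-cancelˡ (a ∷ x) {_ ∷ _} {_ ∷ _} e =
  cong₂ _∷_ (+-cancelˡ-≡ a _ _ (∷-injectiveˡ e)) (∪-cancelˡ x (∷-injectiveʳ e))

lookup-∪ : (d : Fin n) (x y : Bag n) → lookup (x ∪ y) d ≡ lookup x d ℕ.+ lookup y d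
lookup-∪ = lookup-zipWith ℕ._+_

lookup-⟅⟆ : (d : Fin n) → lookup ⟅ d ⟆ d ≡ 1
lookup-⟅⟆ d = lookup∘update d ∅ 1

lookup-⟅⟆-≢ : {d e : Fin n} → d ≢ e → lookup ⟅ e ⟆ d ≡ 0
lookup-⟅⟆-≢ {d = d} d≢e = trans (lookup∘update′ d≢e ∅ 1) (lookup-replicate d 0)

∉-⟅⟆∪ : (d : Fin n) (x : Bag n) → ¬ (d ∉ ⟅ d ⟆ ∪ x)
∉-⟅⟆∪ d x e with trans (sym (trans (lookup-∪ d ⟅ d ⟆ x) (cong (ℕ._+ lookup x d) (lookup-⟅⟆ d)))) e
... | ()

∉-⟅⟆∪⁺ : ∀ {d e : Fin n} x → e ≢ d → e ∉ x → e ∉ ⟅ d ⟆ ∪ x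
∉-⟅⟆∪⁺ {d = d} {e} x e≢d e∉x =
  trans (lookup-∪ e ⟅ d ⟆ x) (cong₂ ℕ._+_ (lookup-⟅⟆-≢ e≢d) e∉x)

∉-⟅⟆∪⁻ : ∀ {d e : Fin n} x → e ≢ d → e ∉ ⟅ d ⟆ ∪ x → e ∉ x
∉-⟅⟆∪⁻ {d = d} {e} x e≢d e∉ =
  trans (cong (ℕ._+ lookup x e) (sym (lookup-⟅⟆-≢ e≢d))) (trans (sym (lookup-∪ e ⟅ d ⟆ x)) e∉)

extract : (d : Fin n) (x : Bag n) → ¬ (d ∉ x) → ∃[ y ] x ≡ ⟅ d ⟆ ∪ y
extract zero    (zero ∷ x)  d∈x = contradiction refl d∈x
extract zero    (suc k ∷ x) d∈x = k ∷ x , cong (suc k ∷_) (sym (∪-identityˡ x))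
extract (suc d) (k ∷ x)     d∈x with extract d x d∈x
... | y , e = k ∷ y , cong (k ∷_) e

module _ {Port B : Set} {n : ℕ} (i o : Port) where

  private
    Act : Set
    Act = Action Port B (Fin n)
    io : List Port
    io = i ∷ o ∷ []

  -- The effect of ∂ and τ on a label: a is not blocked, and appears as b.
  data Exposed : Label Act → Label Act → Set where
    internal : ∀ {a} → Communication io a → Exposed a τ
    external : ∀ {a} → ¬ COM io a → ¬ Communication io a → Exposed a a

  module _ (L : LTS Act) where
    open LTS L

    -- Labels are those before encapsulation and hiding. The unsynchronised sends and receives of
    -- the bag are already left out, since encapsulation blocks them.
    data BagStep : State × Bag n → Label Act → State × Bag n → Set where
      own  : ∀ {s a s′ x} → Step s a s′ → BagStep (s , x) a (s′ , x)
      put  : ∀ {s d s′ x} → Step s (act (send i d)) s′ →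
             BagStep (s , x) (act (communication i d)) (s′ , ⟅ d ⟆ ∪ x)
      take : ∀ {s d s′ x y} → Step s (act (receive o d)) s′ → y ≡ ⟅ d ⟆ ∪ x →
             BagStep (s , y) (act (communication o d)) (s′ , x)
      get  : ∀ {s d s′ x y} → Step s (act (get⁺ o d)) s′ → y ≡ ⟅ d ⟆ ∪ x →
             BagStep (s , y) (act (communication o d)) (s′ , x)
      -- The bag never sends on other ports than o.
      fail : ∀ {s c d s′ x} → Step s (act (get⁻ c d)) s′ → (c ≡ o → d ∉ x) →
             BagStep (s , x) (act (failedCommunication c d)) (s′ , x)

    bagLTS : LTS Act
    bagLTS = record
      { State  = State × Bag n
      ; Step   = λ u b v → ∃[ a ] (BagStep u a v × Exposed a b)
      ; Accept = λ (s , _) → Accept s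
      }

  bagGraph : ProcessGraph Act → ProcessGraph Act
  bagGraph q = record { lts = bagLTS (ProcessGraph.lts q) ; root = ProcessGraph.root q , ∅ }

module _ {Port B : Set} {n : ℕ} {i o : Port} (i≢o : i ≢ o)
         (L : LTS (Action Port B (Fin n))) where
  private
    module L = LTS L
    P : Set
    P = Proc Port B (Fin n) L.State ⊤
    io : List Port
    io = i ∷ o ∷ []
    Holder : Fin n → P
    Holder d = 𝟏 ＋ act (send o d) · 𝟏
    Receiver : Fin n → P
    Receiver d = act (receive i d) · (AB i o ∥ Holder d)

  open Semantics L (AB-def i o)

  ∑-step⁻ : ∀ {m a p′} (f : Fin m → P) → ∑ f ⟶[ a ] p′ → ∃[ d ] (f d ⟶[ a ] p′)
  ∑-step⁻ {suc m} f (＋ˡ r) = zero , r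
  ∑-step⁻ {suc m} f (＋ʳ r) with ∑-step⁻ (f ∘ suc) r
  ... | d , r′ = suc d , r′

  ∑-step⁺ : ∀ {m a p′} (f : Fin m → P) (d : Fin m) → f d ⟶[ a ] p′ → ∑ f ⟶[ a ] p′
  ∑-step⁺ f zero    r = ＋ˡ r
  ∑-step⁺ f (suc d) r = ＋ʳ (∑-step⁺ (f ∘ suc) d r)

  -- Every term reachable from `AB` is a left-nested chain that starts with `AB` and continues with
  -- holders or, where a datum has been sent, with `𝟏`. By `react` this shape is closed under
  -- transitions.
  data Holds : P → Bag n → Set where
    fresh   : Holds (AB i o) ∅
    full    : ∀ {t x} d → Holds t x → Holds (t ∥ Holder d) (⟅ d ⟆ ∪ x)
    emptied : ∀ {t x} → Holds t x → Holds (t ∥ 𝟏) x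

  data Reaction (x : Bag n) (t′ : P) : Label (Action Port B (Fin n)) → Set where
    receives : ∀ {d} → Holds t′ (⟅ d ⟆ ∪ x) → Reaction x t′ (act (receive i d))
    sends    : ∀ {d y} → x ≡ ⟅ d ⟆ ∪ y → Holds t′ y → Reaction x t′ (act (send o d))

  -- Induction along the chain. A received datum enters at the inner end, next to `AB`, hence the
  -- exchange of bags. The components never interact with each other: they only receive on `i` and
  -- send on `o`.
  react : ∀ {t x a t′} → Holds t x → t ⟶[ a ] t′ → Reaction x t′ a
  react fresh (unfold (＋ʳ r)) with ∑-step⁻ Receiver r
  ... | d , prefix = receives (full d fresh)
  react (full d h) (∥ˡ r) with react h r
  ... | receives h′ = receives (subst (Holds _) (∪-exchange _ _ _) (full d h′))
  ... | sends refl h′ = sends (∪-exchange _ _ _) (full d h′)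
  react (full d h) (∥ʳ (＋ʳ prefix)) = sends refl (emptied h)
  react (full d h) (sendˡ _ (＋ʳ ()))
  -- The inner part receives on `i` and the holder sends on `o`, so this communication would need
  -- `i ≡ o`.
  react (full d h) (sendʳ r (＋ʳ prefix)) with react h r
  ... | receives _ = contradiction refl i≢o
  react (full d h) (getˡ r _) with react h r
  ... | ()
  react (full d h) (getʳ _ (＋ʳ ()))
  react (full d h) (failˡ r _) with react h r
  ... | ()
  react (full d h) (failʳ (＋ʳ ()) _)
  react (emptied h) (∥ˡ r) with react h r
  ... | receives h′ = receives (emptied h′)
  ... | sends e h′ = sends e (emptied h′)
  react (emptied h) (getˡ r _) with react h r
  ... | ()
  react (emptied h) (failˡ r _) with react h r
  ... | ()

  can-receive : ∀ {t x} d → Holds t x →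
                ∃[ t′ ] (t ⟶[ act (receive i d) ] t′ × Holds t′ (⟅ d ⟆ ∪ x))
  can-receive d fresh = _ , unfold (＋ʳ (∑-step⁺ Receiver d prefix)) , full d fresh
  can-receive d (full e h) with can-receive d h
  ... | _ , r , h′ = _ , ∥ˡ r , subst (Holds _) (∪-exchange _ _ _) (full e h′)
  can-receive d (emptied h) with can-receive d h
  ... | _ , r , h′ = _ , ∥ˡ r , emptied h′

  can-send : ∀ {t x} d → Holds t x → ¬ (d ∉ x) → ∃[ t′ ] (t ⟶[ act (send o d) ] t′)
  can-send d fresh d∈x = contradiction (lookup-replicate d 0) d∈x
  can-send d (full {x = x} e h) d∈x with d ≟ e
  ... | yes refl = _ , ∥ʳ (＋ʳ prefix)
  ... | no d≢e with can-send d h (λ d∉x → d∈x (∉-⟅⟆∪⁺ x d≢e d∉x))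
  ...   | _ , r = _ , ∥ˡ r
  can-send d (emptied h) d∈x with can-send d h d∈x
  ... | _ , r = _ , ∥ˡ r

  -- `can-send` yields only a transition; `react` tells what it leaves behind, and cancellation
  -- identifies that bag with `y`.
  can-send-∪ : ∀ {t d y} → Holds t (⟅ d ⟆ ∪ y) → ∃[ t′ ] (t ⟶[ act (send o d) ] t′ × Holds t′ y)
  can-send-∪ {d = d} h with can-send d h (∉-⟅⟆∪ d _)
  ... | _ , r with react h r
  ...   | sends e h′ = _ , r , subst (Holds _) (sym (∪-cancelˡ ⟅ d ⟆ e)) h′

  -- By `react`, a chain sends only on `o` and only data it holds. With `noSend⁻`, the negative
  -- premise becomes a test on the bag.
  noSend : ∀ {t x c d} → Holds t x → (c ≡ o → d ∉ x) → NoSend c d t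
  noSend {d = d} h d∉x = NoSend-complete λ _ r → blocked (react h r) d∉x
    where
    blocked : ∀ {x t′ c} → Reaction x t′ (act (send c d)) → ¬ (c ≡ o → d ∉ x)
    blocked (sends {y = y} refl _) d∉x = ∉-⟅⟆∪ d y (d∉x refl)

  noSend⁻ : ∀ {t x d} → Holds t x → NoSend o d t → d ∉ x
  noSend⁻ {x = x} {d} h ns with lookup x d ℕₚ.≟ 0
  ... | yes d∉x = d∉x
  ... | no  d∈x with can-send d h d∈x
  ...   | _ , r = contradiction r (NoSend-sound ns _)

  holds-accepts : ∀ {t x} → Holds t x → Accepting t
  holds-accepts fresh       = var↓ (＋ˡ↓ 𝟏↓)
  holds-accepts (full d h)  = ∥↓ (holds-accepts h) (＋ˡ↓ 𝟏↓)
  holds-accepts (emptied h) = ∥↓ (holds-accepts h) 𝟏↓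

  WithBag : REL P (L.State × Bag n) 0ℓ
  WithBag p (s , x) = ∃[ t ] (p ≡ hide io (∂ io (⌜ s ⌝ ∥ t)) × Holds t x)

  -- Actions of the bag alone lie in `COM`, and by `react` the bag performs no gets or failed gets;
  -- the remaining rules correspond to the constructors of `BagStep`.
  react-∥ : ∀ {s t x a p} → Holds t x → (⌜ s ⌝ ∥ t) ⟶[ a ] p → ¬ COM io a →
            ∃[ s′ ] ∃[ t′ ] ∃[ x′ ]
            (p ≡ (⌜ s′ ⌝ ∥ t′) × Holds t′ x′ × BagStep i o L (s , x) a (s′ , x′))
  react-∥ h (∥ˡ (state q)) _ = _ , _ , _ , refl , h , own q
  react-∥ h (∥ʳ r) ¬com with react h r
  ... | receives _ = contradiction (receive (here refl)) ¬com
  ... | sends _ _  = contradiction (send (there (here refl))) ¬com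
  react-∥ h (sendˡ (state q) r) _ with react h r
  ... | receives h′ = _ , _ , _ , refl , h′ , put q
  react-∥ h (sendʳ (state q) r) _ with react h r
  ... | sends e h′ = _ , _ , _ , refl , h′ , take q e
  react-∥ h (getˡ (state q) r) _ with react h r
  ... | sends e h′ = _ , _ , _ , refl , h′ , get q e
  react-∥ h (getʳ _ r) _ with react h r
  ... | ()
  react-∥ h (failˡ (state q) ns) _ = _ , _ , _ , refl , h , fail q λ { refl → noSend⁻ h ns }
  react-∥ h (failʳ r _) _ with react h r
  ... | ()

  run-∥ : ∀ {s t x a s′ x′} → Holds t x → BagStep i o L (s , x) a (s′ , x′) →
          ∃[ t′ ] ((⌜ s ⌝ ∥ t) ⟶[ a ] (⌜ s′ ⌝ ∥ t′) × Holds t′ x′)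
  run-∥ h (own q) = _ , ∥ˡ (state q) , h
  run-∥ h (put q) with can-receive _ h
  ... | _ , r , h′ = _ , sendˡ (state q) r , h′
  run-∥ h (take q refl) with can-send-∪ h
  ... | _ , r , h′ = _ , sendʳ (state q) r , h′
  run-∥ h (get q refl) with can-send-∪ h
  ... | _ , r , h′ = _ , getˡ (state q) r , h′
  run-∥ h (fail q ns) = _ , failˡ (state q) (noSend h ns) , h

  communication-unblocked : ∀ {C : List Port} {a : Label (Action Port B (Fin n))} →
                            Communication C a → ¬ COM C a
  communication-unblocked (succeeded _) ()
  communication-unblocked (failed _)    ()

  bag-step : ∀ {p u a p′} → WithBag p u → p ⟶[ a ] p′ →
             ∃[ u′ ] (LTS.Step (bagLTS i o L) u a u′ × WithBag p′ u′)
  bag-step (_ , refl , h) (hidden (encap r ¬b) c) with react-∥ h r ¬b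
  ... | _ , _ , _ , refl , h′ , q = _ , (_ , q , internal c) , (_ , refl , h′)
  bag-step (_ , refl , h) (visible (encap r ¬b) ¬c) with react-∥ h r ¬b
  ... | _ , _ , _ , refl , h′ , q = _ , (_ , q , external ¬b ¬c) , (_ , refl , h′)

  unbag-step : ∀ {p u a u′} → WithBag p u → LTS.Step (bagLTS i o L) u a u′ →
               ∃[ p′ ] (p ⟶[ a ] p′ × WithBag p′ u′)
  unbag-step (_ , refl , h) (_ , q , e) with run-∥ h q | e
  ... | _ , r , h′ | internal c     =
    _ , hidden (encap r (communication-unblocked c)) c , (_ , refl , h′)
  ... | _ , r , h′ | external ¬b ¬c =
    _ , visible (encap r ¬b) ¬c , (_ , refl , h′)

  bag-accept : ∀ {p u} → WithBag p u → Accepting p → LTS.Accept (bagLTS i o L) u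
  bag-accept (_ , refl , _) (hide↓ (∂↓ (∥↓ (⌜⌝↓ a) _))) = a

  unbag-accept : ∀ {p u} → WithBag p u → LTS.Accept (bagLTS i o L) u → Accepting p
  unbag-accept (_ , refl , h) a = hide↓ (∂↓ (∥↓ (⌜⌝↓ a) (holds-accepts h)))

withBag≃bagGraph : ∀ {Port B : Set} {n} {i o : Port} → i ≢ o →
                   (q : ProcessGraph (Action Port B (Fin n))) → withBag i o q ≃ bagGraph i o q
withBag≃bagGraph i≢o q =
  WithBag i≢o L ,
  simulation record { step = bag-step i≢o L ; accept = bag-accept i≢o L } ,
  simulation record { step = unbag-step i≢o L ; accept = unbag-accept i≢o L } ,
  _ , refl , fresh
  where
  open ProcessGraph q using () renaming (lts to L)

-- A control for a parallel pushdown automaton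

module FiniteGraph (em : ExcludedMiddle 0ℓ) {A : Set} (G : ProcessGraph A) where
  open ProcessGraph G

  module _ (states : List State) (labels : List (Label A)) (root∈ : root ∈ states)
           (step∈ : ∀ {s a t} → s ∈ states → Step s a t → a ∈ labels × t ∈ states) where

    private
      N : ℕ
      N = List.length states
      decode : Fin N → State
      decode = List.lookup states

      triples : List (Fin N × Label A × Fin N)
      triples = cartesianProduct (allFin N) (cartesianProduct labels (allFin N))

      IsStep : Fin N × Label A × Fin N → Set
      IsStep (j , a , k) = Step (decode j) a (decode k)

    -- Excluded middle selects the actual transitions among finitely many candidates. Repetitions in
    -- `states` are harmless: they give several automaton states that decode to the same state.
    automaton : FiniteAutomaton A
    automaton = record
      { states      = N
      ; transitions = filter (λ t → em {IsStep t}) triples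
      ; initial     = index root∈
      ; accepting   = Vec.tabulate λ j → does (em {Accept (decode j)})
      }

    private
      module A = FiniteAutomaton automaton

    Decodes : REL (Fin N) State 0ℓ
    Decodes j s = s ≡ decode j

    decode-simulation : IsStrongSimulation (ProcessGraph.lts A.graph) lts Decodes
    decode-simulation = record
      { step   = λ { refl x → _ , proj₂ (∈-filter⁻ (λ t → em {IsStep t}) {xs = triples} x) , refl }
      ; accept = λ { {j} refl a → accepted em (trans (sym (lookup∘tabulate _ j)) ([]=⇒lookup a)) }
      }
      where
      accepted : ∀ {P : Set} (P? : Dec P) → does P? ≡ true → P
      accepted (yes p) _ = p

    encode-simulation : IsStrongSimulation lts (ProcessGraph.lts A.graph) (flip Decodes)
    encode-simulation = record
      { step   = λ { {t = j} refl x → let l , t∈ = step∈ (∈-lookup j) x in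
          index t∈ ,
          ∈-filter⁺ (λ t → em {IsStep t})
            (∈-cartesianProduct⁺ (∈-allFin j) (∈-cartesianProduct⁺ l (∈-allFin (index t∈))))
            (subst (Step _ _) (lookup-index t∈) x) ,
          lookup-index t∈ }
      ; accept = λ { {t = j} refl a → lookup⇒[]= j _ (trans (lookup∘tabulate _ j) (dec-true em a)) }
      }

BagLift : {X Y : Set} → REL X Y 0ℓ → REL (X × Bag n) (Y × Bag n) 0ℓ
BagLift R (s , x) (t , y) = R s t × x ≡ y

module _ {Port B : Set} {n : ℕ} (i o : Port) {L K : LTS (Action Port B (Fin n))}
         {R : REL (LTS.State L) (LTS.State K) 0ℓ} where

  -- The negative premise of a failed get concerns the bag, which is the same on both sides, so a
  -- simulation of controls in one direction lifts.
  bag-simulation : IsStrongSimulation L K R →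
                   IsStrongSimulation (bagLTS i o L) (bagLTS i o K) (BagLift R)
  bag-simulation F = record
    { step   = λ { (r , refl) (a , x , e) → let v , y , r′ = lift r x in v , (a , y , e) , r′ }
    ; accept = λ (r , _) → accept r
    }
    where
    open IsStrongSimulation F
    lift : ∀ {s t x a v} → R s t → BagStep i o L (s , x) a v →
           ∃[ w ] (BagStep i o K (t , x) a w × BagLift R v w)
    lift r (own q)    = let _ , q′ , r′ = step r q in _ , own q′ , r′ , refl
    lift r (put q)    = let _ , q′ , r′ = step r q in _ , put q′ , r′ , refl
    lift r (take q e) = let _ , q′ , r′ = step r q in _ , take q′ e , r′ , refl
    lift r (get q e)  = let _ , q′ , r′ = step r q in _ , get q′ e , r′ , refl
    lift r (fail q f) = let _ , q′ , r′ = step r q in _ , fail q′ f , r′ , refl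

-- Bounded vectors of natural numbers

boundedVecs : ℕ → (n : ℕ) → List (Vec ℕ n)
boundedVecs m zero    = [] ∷ []
boundedVecs m (suc n) = cartesianProductWith _∷_ (upTo m) (boundedVecs m n)

∈-boundedVecs⁺ : ∀ {m} (v : Vec ℕ n) → (∀ e → lookup v e < m) → v ∈ boundedVecs m n
∈-boundedVecs⁺ []      _ = here refl
∈-boundedVecs⁺ (_ ∷ v) b =
  ∈-cartesianProductWith⁺ _∷_ (∈-upTo⁺ (b zero)) (∈-boundedVecs⁺ v (b ∘ suc))

∈-boundedVecs⁻ : ∀ {m} {v : Vec ℕ n} → v ∈ boundedVecs m n → ∀ e → lookup v e < m
∈-boundedVecs⁻ {suc n} {m} v∈ e
  with ∈-cartesianProductWith⁻ _∷_ (upTo m) (boundedVecs m n) v∈ | e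
... | _ , _ , k∈ , w∈ , refl | zero  = ∈-upTo⁻ k∈
... | _ , _ , k∈ , w∈ , refl | suc e = ∈-boundedVecs⁻ w∈ e

lookup≤sum : (v : Vec ℕ n) (e : Fin n) → lookup v e ≤ Vec.sum v
lookup≤sum (k ∷ v) zero    = m≤m+n k _
lookup≤sum (k ∷ v) (suc e) = ≤-trans (lookup≤sum v e) (m≤n+m _ k)

lookup-[]≔-< : ∀ {m} (v : Vec ℕ n) (d : Fin n) {b : ℕ} → b < lookup v d →
               (∀ e → lookup v e < m) → ∀ e → lookup (v [ d ]≔ b) e < m
lookup-[]≔-< v d {b} b< bound e with e ≟ d
... | yes refl = subst (_< _) (sym (lookup∘update d v b)) (<-trans b< (bound d))
... | no e≢d   = subst (_< _) (sym (lookup∘update′ e≢d v b)) (bound e)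

sum-[]≔-< : (v : Vec ℕ n) (d : Fin n) {b : ℕ} → b < lookup v d → Vec.sum (v [ d ]≔ b) < Vec.sum v
sum-[]≔-< (_ ∷ v) zero    b< = +-monoˡ-< (Vec.sum v) b<
sum-[]≔-< (k ∷ v) (suc d) b< = +-monoʳ-< k (sum-[]≔-< v d b<)

-- The guard of a pushdown transition is separated from the transition so that it can be evaluated
-- both on the whole bag and on the copies held by the control.
data Fires {n : ℕ} : Bag n → Signed (Fin n) → Bag n → Set where
  removes : ∀ {d x y} → y ≡ ⟅ d ⟆ ∪ x → Fires y (⊕ d) x
  lacks   : ∀ {d x} → d ∉ x → Fires x (⊝ d) x

fires-≤ : ∀ {x : Bag n} {g y} → Fires x g y → ∀ e → lookup y e ≤ lookup x e
fires-≤ (removes {d} {y} refl) e = ≤-trans (m≤n+m _ _) (≤-reflexive (sym (lookup-∪ e ⟅ d ⟆ y)))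
fires-≤ (lacks _)              e = ≤-refl

module _ {B : Set} (M : PPDA B) where
  open PPDA M

  fires⇒step : ∀ {s a g z t x y} → (s , a , g , z , t) ∈ transitions → Fires x g y →
               Step (s , x) a (t , z ∪ y)
  fires⇒step t∈ (removes e) = remove t∈ e
  fires⇒step t∈ (lacks e)   = absent t∈ e

  step⇒fires : ∀ {s x a v} → Step (s , x) a v →
               ∃[ g ] ∃[ z ] ∃[ t ] ∃[ y ]
               ((s , a , g , z , t) ∈ transitions × Fires x g y × v ≡ (t , z ∪ y))
  step⇒fires (remove t∈ e) = _ , _ , _ , _ , t∈ , removes e , refl
  step⇒fires (absent t∈ e) = _ , _ , _ , _ , t∈ , lacks e , refl

module _ (f : ℕ → ℕ) where

  map-[]≔-suc : (v : Vec ℕ n) (d : Fin n) {b : ℕ} → f b ≡ suc (f (lookup v d)) →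
                Vec.map f (v [ d ]≔ b) ≡ ⟅ d ⟆ ∪ Vec.map f v
  map-[]≔-suc (k ∷ v) zero    e = cong₂ _∷_ e (sym (∪-identityˡ (Vec.map f v)))
  map-[]≔-suc (k ∷ v) (suc d) e = cong (f k ∷_) (map-[]≔-suc v d e)

  map-[]≔-pred : (v : Vec ℕ n) (d : Fin n) {b : ℕ} → suc (f b) ≡ f (lookup v d) →
                 ⟅ d ⟆ ∪ Vec.map f (v [ d ]≔ b) ≡ Vec.map f v
  map-[]≔-pred (k ∷ v) zero    e = cong₂ _∷_ e (∪-identityˡ (Vec.map f v))
  map-[]≔-pred (k ∷ v) (suc d) e = cong (f k ∷_) (map-[]≔-pred v d e)

  map-[]≔-same : (v : Vec ℕ n) (d : Fin n) {b : ℕ} → f b ≡ f (lookup v d) →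
                 Vec.map f (v [ d ]≔ b) ≡ Vec.map f v
  map-[]≔-same (k ∷ v) zero    e = cong (_∷ Vec.map f v) e
  map-[]≔-same (k ∷ v) (suc d) e = cong (f k ∷_) (map-[]≔-same v d e)

-- Besides the state of the pushdown automaton, the control stores a status for
-- every datum d: 0 if the bag is known to contain no d, 1 if the control has
-- taken one d out of the bag, and 2 + k if the control still has to put k
-- copies of d into the bag and will then inquire after d.
pattern missing!   = 0
pattern held!      = 1
pattern pending! k = suc (suc k)

content : ℕ → ℕ
content missing!     = 0
content held!        = 1
content (pending! k) = k

-- Every status is `missing!` or `held!`. By `map-content-known`, `v` is then itself the bag of held
-- copies.
Known : Vec ℕ n → Set
Known v = ∀ e → lookup v e ≤ 1

module _ {n : ℕ} (v x : Bag n) where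

  -- Read on statuses, `e ∉ v` says that `e` is `missing!`, the status 0.
  Consistent : Set
  Consistent = ∀ e → e ∉ v → e ∉ x

  fires-∪⁺ : Consistent → ∀ {g v′} → Fires v g v′ → Fires (v ∪ x) g (v′ ∪ x)
  fires-∪⁺ c (removes {d} {v′} e) = removes (trans (cong (_∪ x) e) (∪-assoc ⟅ d ⟆ v′ x))
  fires-∪⁺ c (lacks {d} d∉v) = lacks (trans (lookup-∪ d v x) (cong₂ ℕ._+_ d∉v (c d d∉v)))

  -- A guard removes a single copy, and this copy can be found in `v`: if `d` were absent from `v`,
  -- consistency would make it absent from `v ∪ x`.
  fires-∪⁻ : Consistent → ∀ {g z} → Fires (v ∪ x) g z → ∃[ v′ ] (Fires v g v′ × z ≡ v′ ∪ x)
  fires-∪⁻ c (removes {d} {z} e) with extract d v d∈v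
    where
    d∈v : ¬ (d ∉ v)
    d∈v d∉v = ∉-⟅⟆∪ d z (trans (cong (λ y → lookup y d) (sym e))
                (trans (lookup-∪ d v x) (cong₂ ℕ._+_ d∉v (c d d∉v))))
  ... | v′ , e′ = v′ , removes e′ ,
    ∪-cancelˡ ⟅ d ⟆ (trans (sym e) (trans (cong (_∪ x) e′) (∪-assoc ⟅ d ⟆ v′ x)))
  fires-∪⁻ c (lacks {d} d∉) = v , lacks (m+n≡0⇒m≡0 _ (trans (sym (lookup-∪ d v x)) d∉)) , refl

consistent-[]≔ : (v x x′ : Bag n) (d : Fin n) (b : ℕ) →
                 (∀ {e} → e ≢ d → e ∉ x → e ∉ x′) → (b ≡ 0 → d ∉ x′) →
                 Consistent v x → Consistent (v [ d ]≔ b) x′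
consistent-[]≔ v x x′ d b elsewhere at-d c e e∉ with e ≟ d
... | yes refl = at-d (trans (sym (lookup∘update d v b)) e∉)
... | no e≢d   = elsewhere e≢d (c e (trans (sym (lookup∘update′ e≢d v b)) e∉))

map-content-pending : (z : Bag n) → Vec.map content (Vec.map (λ k → pending! k) z) ≡ z
map-content-pending z = trans (sym (map-∘ content _ z)) (map-id z)

map-content-known : (v : Vec ℕ n) → Known v → Vec.map content v ≡ v
map-content-known []      _ = refl
map-content-known (k ∷ v) p = cong₂ _∷_ (known k (p zero)) (map-content-known v (p ∘ suc))
  where
  known : ∀ k → k ≤ 1 → content k ≡ k
  known missing!     _        = refl
  known held!        _        = refl
  known (pending! _) (s≤s ())

-- The control and its correctness

module _ {Port B : Set} (i o : Port) (M : PPDA B) where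
  open PPDA M hiding (State; Step)

  private
    Act : Set
    Act = Action Port B (Fin data#)

  ControlState : Set
  ControlState = Fin states × Vec ℕ data#

  -- `fire` makes every datum pending, even one with no copy to put back, so that presence and
  -- absence are established afresh before the next firing.
  data Control : ControlState → Label Act → ControlState → Set where
    emit    : ∀ {s v d k} → lookup v d ≡ pending! (suc k) →
              Control (s , v) (act (send i d)) (s , v [ d ]≔ pending! k)
    found   : ∀ {s v d} → lookup v d ≡ pending! 0 →
              Control (s , v) (act (get⁺ o d)) (s , v [ d ]≔ held!)
    missing : ∀ {s v d} → lookup v d ≡ pending! 0 →
              Control (s , v) (act (get⁻ o d)) (s , v [ d ]≔ missing!)
    fire    : ∀ {s v a b g z t v′} → (s , a , g , z , t) ∈ transitions → Known v →
              Fires v g v′ → b ≡ Maybe.map basic a →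
              Control (s , v) b (t , Vec.map (λ k → pending! k) (z ∪ v′))

  controlGraph : ProcessGraph Act
  controlGraph = record
    { lts  = record
      { State  = ControlState
      ; Step   = Control
      ; Accept = λ (s , _) → s ∈ₛ accepting
      }
    ; root = initial , Vec.map (λ k → pending! k) ∅
    }

  private
    module C = LTS (bagLTS i o (ProcessGraph.lts controlGraph))
    module P = ProcessGraph (rename (basic {Port} {B} {Fin data#}) 𝒫)

  data Represents : C.State → P.State → Set where
    rep : ∀ {s v x y} → y ≡ Vec.map content v ∪ x → Consistent v x →
          Represents ((s , v) , x) (s , y)

  -- The statuses are numbered so that each communication lowers one of them: `emit` and `found` by
  -- one, `missing` by two.
  measure : C.State → ℕ
  measure ((_ , v) , _) = Vec.sum v

  Inert : C.State → C.State → Set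
  Inert u u′ = measure u′ < measure u × (∀ {m} → Represents u m → Represents u′ m)

  emit-inert : ∀ {s v x} d {k} → lookup v d ≡ pending! (suc k) →
               Inert ((s , v) , x) ((s , v [ d ]≔ pending! k) , ⟅ d ⟆ ∪ x)
  emit-inert {v = v} {x} d {k} e =
    sum-[]≔-< v d (subst (_ <_) (sym e) ≤-refl) , λ { (rep refl c) → rep
      (trans (cong (_∪ x) (sym (map-[]≔-pred content v d (cong content (sym e)))))
             (trans (∪-assoc ⟅ d ⟆ v′ x) (∪-exchange ⟅ d ⟆ v′ x)))
      (consistent-[]≔ v x (⟅ d ⟆ ∪ x) d (pending! k) (∉-⟅⟆∪⁺ x) (λ ()) c) }
    where
    v′ : Bag data#
    v′ = Vec.map content (v [ d ]≔ pending! k)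

  found-inert : ∀ {s v x y} d → lookup v d ≡ pending! 0 → y ≡ ⟅ d ⟆ ∪ x →
                Inert ((s , v) , y) ((s , v [ d ]≔ held!) , x)
  found-inert {v = v} {x} d e refl =
    sum-[]≔-< v d (subst (_ <_) (sym e) ≤-refl) , λ { (rep refl c) → rep
      (trans (∪-exchange v′ ⟅ d ⟆ x)
        (trans (sym (∪-assoc ⟅ d ⟆ v′ x))
          (cong (_∪ x) (sym (map-[]≔-suc content v d (cong suc (cong content (sym e))))))))
      (consistent-[]≔ v (⟅ d ⟆ ∪ x) x d held! (∉-⟅⟆∪⁻ x) (λ ()) c) }
    where
    v′ : Bag data#
    v′ = Vec.map content v

  -- Only here does a status become 0, and the failed get provides exactly the absence that
  -- consistency then demands.
  missing-inert : ∀ {s v x} d → lookup v d ≡ pending! 0 → d ∉ x →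
                  Inert ((s , v) , x) ((s , v [ d ]≔ missing!) , x)
  missing-inert {v = v} {x} d e d∉x =
    sum-[]≔-< v d (subst (_ <_) (sym e) (s≤s z≤n)) , λ { (rep refl c) → rep
      (cong (_∪ x) (sym (map-[]≔-same content v d (cong content (sym e)))))
      (consistent-[]≔ v x x d missing! (λ _ e∉ → e∉) (λ _ → d∉x) c) }

  -- After a firing all statuses are at least 2, so consistency holds vacuously.
  represents-fired : ∀ {t x} z v′ →
    Represents ((t , Vec.map (λ k → pending! k) (z ∪ v′)) , x) (t , z ∪ (v′ ∪ x))
  represents-fired {x = x} z v′ =
    rep (trans (sym (∪-assoc z v′ x)) (cong (_∪ x) (sym (map-content-pending (z ∪ v′)))))
        (λ e e∉ → contradiction (trans (sym (lookup-map e _ (z ∪ v′))) e∉) λ ())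

  -- The dichotomy behind the simulation: a step is either inert bookkeeping or a firing that the
  -- pushdown automaton can match.
  control-step : ∀ {u b u′} → C.Step u b u′ →
                 (b ≡ τ × Inert u u′) ⊎
                 (∀ {m} → Represents u m → ∃[ m′ ] (P.Step m b m′ × Represents u′ m′))
  control-step (_ , own (emit _)    , external ¬b _) = contradiction (send (here refl)) ¬b
  control-step (_ , own (found _)   , external ¬b _) = contradiction (get⁺ (there (here refl))) ¬b
  control-step (_ , own (missing _) , external ¬b _) = contradiction (get⁻ (there (here refl))) ¬b
  -- A firing is labelled `τ` or `basic`, so it is neither hidden nor synchronised; the case split
  -- on `a` exposes the clash of labels.
  control-step (_ , own (fire {a = nothing} _ _ _ ()) , internal (succeeded _))
  control-step (_ , own (fire {a = just _} _ _ _ ())  , internal (succeeded _))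
  control-step (_ , own (fire {a = nothing} _ _ _ ())  , internal (failed _))
  control-step (_ , own (fire {a = just _} _ _ _ ())  , internal (failed _))
  control-step (_ , own {x = x} (fire {v = v} {a = a} {z = z} {v′ = v′} t∈ known f e) ,
                external _ _) =
    inj₂ λ { (rep refl c) → _ ,
      (a , e , fires⇒step M t∈ (subst (λ w → Fires (w ∪ x) _ _)
                                 (sym (map-content-known v known)) (fires-∪⁺ v x c f))) ,
      represents-fired z v′ }
  control-step (_ , put (emit {d = d} e) , internal _) = inj₁ (refl , emit-inert d e)
  control-step (_ , put (emit _) , external _ ¬c) =
    contradiction (succeeded (here refl)) ¬c
  control-step (_ , put (fire {a = nothing} _ _ _ ()) , _)
  control-step (_ , put (fire {a = just _}  _ _ _ ()) , _)
  control-step (_ , take (fire {a = nothing} _ _ _ ()) _ , _)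
  control-step (_ , take (fire {a = just _}  _ _ _ ()) _ , _)
  control-step (_ , get (found {d = d} e) e′ , internal _) =
    inj₁ (refl , found-inert d e e′)
  control-step (_ , get (found _) _ , external _ ¬c) =
    contradiction (succeeded (there (here refl))) ¬c
  control-step (_ , get (fire {a = nothing} _ _ _ ()) _ , _)
  control-step (_ , get (fire {a = just _}  _ _ _ ()) _ , _)
  control-step (_ , fail (missing {d = d} e) d∉ , internal _) =
    inj₁ (refl , missing-inert d e (d∉ refl))
  control-step (_ , fail (missing _) _ , external _ ¬c) =
    contradiction (failed (there (here refl))) ¬c
  control-step (_ , fail (fire {a = nothing} _ _ _ ()) _ , _)
  control-step (_ , fail (fire {a = just _}  _ _ _ ()) _ , _)

  -- Progress: a status above 1 always permits a communication, because `found` and `missing` cover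
  -- both possible contents of the bag.
  inquire : ∀ {s v x} d → ¬ (lookup v d ≤ 1) →
            ∃[ v′ ] ∃[ x′ ]
            (C.Step ((s , v) , x) τ ((s , v′) , x′) × Inert ((s , v) , x) ((s , v′) , x′))
  inquire {s} {v} {x} d unknown with lookup v d in e
  ... | missing! = contradiction z≤n unknown
  ... | held!    = contradiction ≤-refl unknown
  ... | pending! (suc k) =
    _ , _ , (_ , put (emit e) , internal (succeeded (here refl))) , emit-inert {s} {v} {x} d e
  ... | pending! 0 with lookup x d ℕₚ.≟ 0
  ...   | yes d∉x =
    _ , _ , (_ , fail (missing e) (λ _ → d∉x) , internal (failed (there (here refl)))) ,
    missing-inert {s} {v} {x} d e d∉x
  ...   | no d∈x with extract d x d∈x
  ...     | x′ , e′ =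
    _ , _ , (_ , get (found e) e′ , internal (succeeded (there (here refl)))) ,
    found-inert {s} {v} d e e′

  -- Inquiries are repeated until all statuses are known; the decreasing measure ends the process,
  -- and inertness preserves the represented state.
  settle : ∀ {s v x m} → Acc _<_ (Vec.sum v) → Represents ((s , v) , x) m →
           ∃[ v′ ] ∃[ x′ ]
           (((s , v) , x) C.⇒ ((s , v′) , x′) × Represents ((s , v′) , x′) m × Known v′)
  settle {v = v} {x} (acc rs) r with all? (λ e → lookup v e ≤? 1)
  ... | yes known = v , x , ε , r , known
  ... | no ¬known with ¬∀⟶∃¬ _ _ (λ e → lookup v e ≤? 1) ¬known
  ...   | d , unknown with inquire d unknown
  ...     | _ , _ , q , (μ< , inert) with settle (rs μ<) (inert r)
  ...       | _ , _ , p , r′ , known = _ , _ , q ◅ p , r′ , known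

  expose-basic : (a : Label B) → Exposed {n = data#} i o (Maybe.map basic a) (Maybe.map basic a)
  expose-basic nothing = external (λ ()) (λ ())
  expose-basic (just _) = external (λ ()) (λ ())

  control-simulation : Simulation (bagLTS i o (ProcessGraph.lts controlGraph)) P.lts
                                  Represents
  control-simulation = record
    { simulates  = sim
    ; terminates = λ { (rep _ _) a → _ , ε , a }
    ; diverges   = λ s d → div s d (<-wellFounded _)
    }
    where
    sim : ∀ {u m b u′} → Represents u m → C.Step u b u′ →
          ∃[ m″ ] ∃[ m′ ] (m P.⇒ m″ × P.OptStep m″ b m′ × Represents u m″ × Represents u′ m′)
    sim r q with control-step q
    ... | inj₁ (refl , _ , inert) = _ , _ , ε , inj₂ (refl , refl) , r , inert r
    ... | inj₂ step = let _ , q′ , r′ = step r in _ , _ , ε , inj₁ q′ , r , r′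

    -- The measure cannot decrease forever, so a divergence contains a firing, which is answered by
    -- a proper τ-step.
    div : ∀ {m} s → (∀ k → C.Step (s k) τ (s (suc k))) → Acc _<_ (measure (s 0)) →
          Represents (s 0) m → ∃[ m′ ] (m P.⇒⁺ m′ × ∃[ k ] Represents (s k) m′)
    div s d (acc rs) r with control-step (d 0)
    ... | inj₂ step = let _ , q′ , r′ = step r in _ , [ q′ ] , 1 , r′
    ... | inj₁ (_ , μ< , inert) =
      let _ , p , k , r′ = div (s ∘ suc) (d ∘ suc) (rs μ<) (inert r) in _ , p , suc k , r′

  -- The control first settles; then the guard, which held of the represented bag, also holds of the
  -- copies held, and the transition can be fired. The answer always contains a step, which also
  -- settles divergences.
  control-simulates : ∀ {u m b m′} → Represents u m → P.Step m b m′ →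
                      ∃[ u″ ] ∃[ u′ ]
                      (u C.⇒ u″ × C.Step u″ b u′ × Represents u″ m × Represents u′ m′)
  control-simulates r@(rep _ _) (a , refl , q) with settle (<-wellFounded _) r
  ... | v , x , p , r′@(rep refl c) , known with step⇒fires M q
  ...   | g , z , t , y , t∈ , f , refl
    with fires-∪⁻ v x c (subst (λ w → Fires (w ∪ x) g y) (map-content-known v known) f)
  ...     | v′ , f′ , refl =
    _ , _ , p , (_ , own (fire t∈ known f′ refl) , expose-basic a) , r′ , represents-fired z v′

  control-simulation⁻ : Simulation P.lts (bagLTS i o (ProcessGraph.lts controlGraph))
                                   (flip Represents)
  control-simulation⁻ = record
    { simulates  = λ r q → let _ , _ , p , q′ , r″ , r′ = control-simulates r q in
                           _ , _ , p , inj₁ q′ , r″ , r′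
    ; terminates = λ { (rep _ _) a → _ , ε , a }
    ; diverges   = λ s d r → let _ , _ , p , q′ , _ , r′ = control-simulates r (d 0) in
                             _ , p ◅◅⁺ q′ , 1 , r′
    }

  bagControl≃𝒫 : bagGraph i o controlGraph ≃ rename basic 𝒫
  bagControl≃𝒫 = Represents , control-simulation , control-simulation⁻ ,
    rep (sym (trans (cong (_∪ ∅) (map-content-pending ∅)) (∪-identityˡ ∅)))
        (λ e _ → lookup-replicate e 0)

  -- Finiteness of the control

  private
    weight : Fin states × Label B × Signed (Fin data#) × Bag data# × Fin states → ℕ
    weight (_ , _ , _ , z , _) = Vec.sum z

    maxWeight : ℕ
    maxWeight = max 0 (List.map weight transitions)

    -- A fired transition puts at most `maxWeight` new copies of a datum beside at most one held
    -- copy. Pending statuses add 2, so all statuses are at most 3 + `maxWeight`, strictly below the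
    -- bound.
    controlStates : List ControlState
    controlStates = cartesianProduct (allFin states) (boundedVecs (4 ℕ.+ maxWeight) data#)

    inquiries : Fin data# → List (Label Act)
    inquiries d = act (send i d) ∷ act (get⁺ o d) ∷ act (get⁻ o d) ∷ []

    controlLabels : List (Label Act)
    controlLabels = List.map (λ (_ , a , _) → Maybe.map basic a) transitions ++
                    concatMap inquiries (allFin data#)

    inquiry∈ : ∀ {a} d → a ∈ inquiries d → a ∈ controlLabels
    inquiry∈ d a∈ = ∈-++⁺ʳ _
      (∈-concatMap⁺ inquiries {xs = allFin data#} (lose (∈-allFin d) a∈))

    state∈ : ∀ {s v} → (∀ e → lookup v e < 4 ℕ.+ maxWeight) → (s , v) ∈ controlStates
    state∈ {s} {v} b = ∈-cartesianProduct⁺ (∈-allFin s) (∈-boundedVecs⁺ v b)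

    root∈ : ProcessGraph.root controlGraph ∈ controlStates
    root∈ = state∈ λ e → subst (_< 4 ℕ.+ maxWeight)
      (sym (trans (lookup-map e _ ∅) (cong (λ k → pending! k) (lookup-replicate e 0))))
      (s≤s (s≤s (s≤s z≤n)))

    -- Communications only lower statuses; a firing resets them to values bounded independently of
    -- the past.
    step∈ : ∀ {u a u′} → u ∈ controlStates → Control u a u′ → a ∈ controlLabels × u′ ∈ controlStates
    step∈ {s , v} u∈ = go
      where
      b : ∀ e → lookup v e < 4 ℕ.+ maxWeight
      b = ∈-boundedVecs⁻ (proj₂ (∈-cartesianProduct⁻ (allFin states) _ u∈))

      fired-bound : ∀ {k l} → k ≤ maxWeight → l ≤ 1 → pending! (k ℕ.+ l) < 4 ℕ.+ maxWeight
      fired-bound k≤ l≤ =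
        s≤s (s≤s (s≤s (≤-trans (+-mono-≤ k≤ l≤) (≤-reflexive (+-comm maxWeight 1)))))

      go : ∀ {a u′} → Control (s , v) a u′ → a ∈ controlLabels × u′ ∈ controlStates
      go (emit {d = d} e) = inquiry∈ d (here refl) ,
        state∈ (lookup-[]≔-< v d (subst (_ <_) (sym e) ≤-refl) b)
      go (found {d = d} e) = inquiry∈ d (there (here refl)) ,
        state∈ (lookup-[]≔-< v d (subst (_ <_) (sym e) ≤-refl) b)
      go (missing {d = d} e) = inquiry∈ d (there (there (here refl))) ,
        state∈ (lookup-[]≔-< v d (subst (_ <_) (sym e) (s≤s z≤n)) b)
      go (fire {z = z} {v′ = v′} t∈ known f refl) =
        ∈-++⁺ˡ (∈-map⁺ (λ (_ , a , _) → Maybe.map basic a) t∈) ,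
        state∈ λ e → subst (_< 4 ℕ.+ maxWeight)
          (sym (trans (lookup-map e _ (z ∪ v′)) (cong (λ k → pending! k) (lookup-∪ e z v′))))
          (fired-bound
            (≤-trans (lookup≤sum z e)
              (All.lookup (xs≤max 0 (List.map weight transitions)) (∈-map⁺ weight t∈)))
            (≤-trans (fires-≤ f e) (known e)))

  module _ (em : ExcludedMiddle 0ℓ) where
    open FiniteGraph em controlGraph

    control : FiniteAutomaton Act
    control = automaton controlStates controlLabels root∈ step∈

    bagAutomaton≃bagControl : bagGraph i o (FiniteAutomaton.graph control) ≃
                              bagGraph i o controlGraph
    bagAutomaton≃bagControl =
      BagLift (Decodes _ _ root∈ step∈) ,
      simulation (bag-simulation i o (decode-simulation _ _ root∈ step∈)) ,
      simulation-resp (λ (r , e) → r , sym e) (λ (r , e) → r , sym e)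
        (simulation (bag-simulation i o (encode-simulation _ _ root∈ step∈))) ,
      lookup-index root∈ , refl

-- A parallel pushdown automaton for a control

module FromAutomaton (em : ExcludedMiddle 0ℓ) {Port B : Set} {n : ℕ} {i o : Port} (i≢o : i ≢ o)
                     (q : FiniteAutomaton (Action Port B (Fin n))) where
  private
    module q = FiniteAutomaton q
    Act : Set
    Act = Action Port B (Fin n)
    io : List Port
    io = i ∷ o ∷ []
    Instruction : Set
    Instruction = Label B × Signed (Fin (suc n)) × Bag (suc n)

  -- The datum zero never occurs in the bag, so that the guard ⊝ zero is no
  -- restriction.
  data Compiles : Label Act → Instruction → Set where
    silent  : Compiles τ (τ , ⊝ zero , ∅)
    visible : ∀ {b} → Compiles (act (basic b)) (act b , ⊝ zero , ∅)
    hidden  : ∀ {a} → Communication io a → Compiles a (τ , ⊝ zero , ∅)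
    put     : ∀ {d} → Compiles (act (send i d)) (τ , ⊝ zero , ⟅ suc d ⟆)
    take    : ∀ {d} → Compiles (act (receive o d)) (τ , ⊕ suc d , ∅)
    get     : ∀ {d} → Compiles (act (get⁺ o d)) (τ , ⊕ suc d , ∅)
    failᵢ   : ∀ {d} → Compiles (act (get⁻ i d)) (τ , ⊝ zero , ∅)
    failₒ   : ∀ {d} → Compiles (act (get⁻ o d)) (τ , ⊝ suc d , ∅)

  -- A finite superset of the instructions for a label, listed without comparing ports; filtering by
  -- `Compiled` with excluded middle then keeps the correct ones.
  candidates : Label Act → List Instruction
  candidates τ                             = (τ , ⊝ zero , ∅) ∷ []
  candidates (act (basic b))               = (act b , ⊝ zero , ∅) ∷ []
  candidates (act (send _ d))              = (τ , ⊝ zero , ⟅ suc d ⟆) ∷ []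
  candidates (act (receive _ d))           = (τ , ⊕ suc d , ∅) ∷ []
  candidates (act (get⁺ _ d))              = (τ , ⊕ suc d , ∅) ∷ []
  candidates (act (get⁻ _ d))              = (τ , ⊝ zero , ∅) ∷ (τ , ⊝ suc d , ∅) ∷ []
  candidates (act (communication _ _))       = (τ , ⊝ zero , ∅) ∷ []
  candidates (act (failedCommunication _ _)) = (τ , ⊝ zero , ∅) ∷ []

  compiles⇒candidate : ∀ {a t} → Compiles a t → t ∈ candidates a
  compiles⇒candidate silent                 = here refl
  compiles⇒candidate visible                = here refl
  compiles⇒candidate (hidden (succeeded _)) = here refl
  compiles⇒candidate (hidden (failed _))    = here refl
  compiles⇒candidate put                    = here refl
  compiles⇒candidate take                   = here refl
  compiles⇒candidate get                    = here refl
  compiles⇒candidate failᵢ                  = here refl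
  compiles⇒candidate failₒ                  = there (here refl)

  Transition : Set
  Transition = Fin q.states × Label B × Signed (Fin (suc n)) × Bag (suc n) × Fin q.states

  Compiled : Transition → Set
  Compiled (s , b , g , z , t) = ∃[ a ] ((s , a , t) ∈ q.transitions × Compiles a (b , g , z))

  private
    attach : Fin q.states → Fin q.states → Instruction → Transition
    attach s t (b , g , z) = s , b , g , z , t

    candidateTransitions : Fin q.states × Label Act × Fin q.states → List Transition
    candidateTransitions (s , a , t) = List.map (attach s t) (candidates a)

    allCandidates : List Transition
    allCandidates = concatMap candidateTransitions q.transitions

  transitions : List Transition
  transitions = filter (λ t → em {Compiled t}) allCandidates

  compiled : ∀ {t} → t ∈ transitions → Compiled t
  compiled t∈ = proj₂ (∈-filter⁻ (λ t → em {Compiled t}) {xs = allCandidates} t∈)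

  compile : ∀ {s a t b g z} → (s , a , t) ∈ q.transitions → Compiles a (b , g , z) →
            (s , b , g , z , t) ∈ transitions
  compile {s} {a} {t} q∈ c = ∈-filter⁺ (λ t → em {Compiled t})
    (∈-concatMap⁺ candidateTransitions (lose q∈ (∈-map⁺ (attach s t) (compiles⇒candidate c))))
    (a , q∈ , c)

  private
    visibleLabel : Transition → List B
    visibleLabel (_ , b , _) = List.fromMaybe b

  M : PPDA B
  M = record
    { states      = q.states
    ; alphabet    = concatMap visibleLabel transitions
    ; data#       = suc n
    ; transitions = transitions
    ; labelled    = λ t∈ → ∈-concatMap⁺ visibleLabel (lose t∈ (here refl))
    ; initial     = q.initial
    ; accepting   = q.accepting
    }

  private
    module BG = ProcessGraph (bagGraph i o q.graph)
    module PG = ProcessGraph (rename (basic {Port} {B} {Fin n}) (PPDA.𝒫 M))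
    module P  = PPDA M

  ⌊_⌋ : BG.State → P.State
  ⌊ s , x ⌋ = s , 0 ∷ x

  ∅∪ : ∀ {s a u} {x : Bag n} → P.Step u a (s , ∅ ∪ (0 ∷ x)) → P.Step u a (s , 0 ∷ x)
  ∅∪ {x = x} = subst (λ y → P.Step _ _ (_ , 0 ∷ y)) (∪-identityˡ x)

  compile-step : ∀ {u a b v} → BagStep i o (ProcessGraph.lts q.graph) u a v →
                 Exposed i o a (Maybe.map basic b) → P.Step ⌊ u ⌋ b ⌊ v ⌋
  compile-step step e = go step e refl
    where
    -- Naming the exposed label `c` permits matching on `Exposed`; the equation then discards
    -- visible labels that are not basic.
    go : ∀ {u a b c v} → BagStep i o (ProcessGraph.lts q.graph) u a v → Exposed i o a c →
         c ≡ Maybe.map basic b → P.Step ⌊ u ⌋ b ⌊ v ⌋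
    go {b = nothing} (own q) (internal c) _      = ∅∪ (P.absent (compile q (hidden c)) refl)
    go {b = nothing} (own q) (external _ _) refl = ∅∪ (P.absent (compile q silent) refl)
    go {b = just _}  (own q) (external _ _) refl = ∅∪ (P.absent (compile q visible) refl)
    go {b = nothing} (put q) (internal _) _      = P.absent (compile q put) refl
    go {b = nothing} (take q e) (internal _) _   = ∅∪ (P.remove (compile q take) (cong (0 ∷_) e))
    go {b = nothing} (get q e) (internal _) _    = ∅∪ (P.remove (compile q get) (cong (0 ∷_) e))
    go {b = nothing} (fail q _) (internal (failed (here refl))) _ =
      ∅∪ (P.absent (compile q failᵢ) refl)
    go {b = nothing} (fail q d∉) (internal (failed (there (here refl)))) _ =
      ∅∪ (P.absent (compile q failₒ) (d∉ refl))

  decompile-step : ∀ {u b m} → P.Step ⌊ u ⌋ b m →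
                   ∃[ v ] (BG.Step u (Maybe.map basic b) v × m ≡ ⌊ v ⌋)
  decompile-step {s , x} p with step⇒fires M p
  ... | g , z , t , y , t∈ , f , refl with compiled t∈
  ...   | a , q , c = go q c f
    where
    unguarded : ∀ {t} → (t , ∅ ∪ (0 ∷ x)) ≡ ⌊ t , x ⌋
    unguarded {t} = cong (λ y → t , 0 ∷ y) (∪-identityˡ x)

    -- Removing `suc d` leaves the multiplicity of datum zero at 0, so the result is again an
    -- encoded bag.
    removed : ∀ {d y} → 0 ∷ x ≡ ⟅ suc d ⟆ ∪ y →
              ∃[ x′ ] (x ≡ ⟅ d ⟆ ∪ x′ × ∀ {t : Fin q.states} → (t , ∅ ∪ y) ≡ ⌊ t , x′ ⌋)
    removed {y = k ∷ x′} e = x′ , ∷-injectiveʳ e ,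
      cong₂ (λ k y → _ , k ∷ y) (sym (∷-injectiveˡ e)) (∪-identityˡ x′)

    go : ∀ {a b g z t y} →
         (s , a , t) ∈ q.transitions → Compiles a (b , g , z) → Fires (0 ∷ x) g y →
         ∃[ v ] (BG.Step (s , x) (Maybe.map basic b) v × (t , z ∪ y) ≡ ⌊ v ⌋)
    go q silent (lacks _)     = _ , (_ , own q , external (λ ()) (λ ())) , unguarded
    go q visible (lacks _)    = _ , (_ , own q , external (λ ()) (λ ())) , unguarded
    go q (hidden c) (lacks _) = _ , (_ , own q , internal c) , unguarded
    go q put (lacks _)        = _ , (_ , put q , internal (succeeded (here refl))) , refl
    go q take (removes e)     = let _ , e′ , r = removed e in
      _ , (_ , take q e′ , internal (succeeded (there (here refl)))) , r
    go q get (removes e)      = let _ , e′ , r = removed e in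
      _ , (_ , get q e′ , internal (succeeded (there (here refl)))) , r
    -- The bag never sends on `i`, so a failed get on `i` is always possible; `i≢o` discharges the
    -- condition.
    go q failᵢ (lacks _)      =
      _ , (_ , fail q (λ i≡o → contradiction i≡o i≢o) , internal (failed (here refl))) , unguarded
    go q failₒ (lacks d∉)     =
      _ , (_ , fail q (λ _ → d∉) , internal (failed (there (here refl)))) , unguarded

  -- The automaton q may have transitions that stay visible although they are
  -- not basic; these cannot be taken in states matched by a state of p.
  module _ (p : ProcessGraph B) (p≃q : rename basic p ≃ bagGraph i o q.graph) where
    private
      module p = ProcessGraph (rename (basic {Port} {B} {Fin n}) p)
      R : REL p.State BG.State 0ℓ
      R = proj₁ p≃q
      open Simulation (proj₁ (proj₂ (proj₂ p≃q)))

    Matched : REL BG.State P.State 0ℓ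
    Matched u m = m ≡ ⌊ u ⌋ × ∃[ s ] R s u

    -- Every answer comes from a renamed graph, which forces the label to be `τ` or basic and hands
    -- over a related state for the next step.
    matched-step : ∀ {s u a v} → R s u → BG.Step u a v →
                   (∃[ b ] a ≡ Maybe.map basic b) × ∃[ s′ ] R s′ v
    matched-step r x with simulates r x
    ... | _ , _ , _ , inj₁ (b , e , _) , _ , r′ = (b , e) , (_ , r′)
    ... | _ , _ , _ , inj₂ (refl , _)  , _ , r′ = (nothing , refl) , (_ , r′)

    bagAutomaton≃𝒫 : bagGraph i o q.graph ≃ rename basic (PPDA.𝒫 M)
    bagAutomaton≃𝒫 =
      Matched ,
      simulation (record
        { step   = matched
        ; accept = λ { (refl , _) a → a } }) ,
      simulation (record
        { step   = λ { (refl , _ , r) (b , refl , x) →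
            let v , y , e = decompile-step x in v , y , e , proj₂ (matched-step r y) }
        ; accept = λ { (refl , _) a → a } }) ,
      (refl , _ , proj₂ (proj₂ (proj₂ p≃q)))
      where
      matched : ∀ {u m a v} → Matched u m → BG.Step u a v → ∃[ m′ ] (PG.Step m a m′ × Matched v m′)
      matched (refl , _ , r) x with matched-step r x | x
      ... | (b , refl) , r′ | _ , y , e = _ , (b , refl , compile-step y e) , (refl , r′)

-- The characterisation of parallel pushdown processes

theorem16 : ExcludedMiddle 0ℓ →
    ∀ {Port B : Set} {i o : Port} → i ≢ o → (p : ProcessGraph B) →
    IsParallelPushdownProcess p ⇔
    (∃[ n ] Σ[ q ∈ FiniteAutomaton (Action Port B (Fin n)) ]
      (rename basic p ≈ᵇ withBag i o (FiniteAutomaton.graph q)))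
theorem16 em {i = i} {o} i≢o p = mk⇔ to from
  where
  to : _ → _
  to (M , p≈M) = PPDA.data# M , control i o M em ,
    ≃⇒≈ᵇ (≃-trans (rename-≃ (≈ᵇ⇒≃ em p≈M))
         (≃-trans (≃-sym (bagControl≃𝒫 i o M))
         (≃-trans (≃-sym (bagAutomaton≃bagControl i o M em))
                  (≃-sym (withBag≃bagGraph i≢o (FiniteAutomaton.graph (control i o M em)))))))

  from : _ → _
  -- The comparison takes place over `Action`; the constructor `basic` is injective, so the renaming
  -- can be cancelled.
  from (n , q , p≈q) = M , ≃⇒≈ᵇ (unrename-≃ (λ { refl → refl })
      (≃-trans p≃q (bagAutomaton≃𝒫 p p≃q)))
    where
    open FromAutomaton em i≢o q
    p≃q : rename basic p ≃ bagGraph _ _ (FiniteAutomaton.graph q)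
    p≃q = ≃-trans (≈ᵇ⇒≃ em p≈q) (withBag≃bagGraph i≢o (FiniteAutomaton.graph q))
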